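{- Let $T=(V,E)$ be a tree on $n$ vertices, let $f=\{i,j\}$ be a pair of vertices with $d_{i,j}=d>1$, and let $B=E\cup\{f\}$. Then the eigenvalues of $\mathrm{Min4PC}_T[B,B]$ are $-2$ with multiplicity $n-3$, together with the three roots of the cubic polynomial $$g(x)=x^3-(2n-6)x^2-(nd^2-5d^2+2nd-2d+5n-9)x-2(d-1)^2(n-1).$$
   Context: $d_{i,j}$ is the distance in $T$ between vertices $i,j$; $\mathcal{V}_2$ is the set of 2-element subsets of $V$ (edges regarded as elements of $\mathcal{V}_2$). $\mathrm{Min4PC}_T$ is the $\binom n2\times\binom n2$ matrix indexed by $\mathcal{V}_2$ whose entry in row $\{i,j\}$, column $\{k,l\}$ is $\min\{d_{i,l}+d_{j,k},\ d_{i,k}+d_{j,l},\ d_{i,j}+d_{k,l}\}$. $M[B,B]$ denotes the principal submatrix with rows and columns indexed by $B$. -}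

module Defs where

open import Algebra.Apartness.Bundles using (HeytingField; HeytingCommutativeRing)
open import Algebra.Bundles using (RawRing; CommutativeRing)
import Algebra.Definitions.RawSemiring as RawSemiringDefs
open import Data.Bool.Base using (if_then_else_)
open import Data.Fin.Base as Fin using (Fin; zero; suc; toℕ; punchIn)
import Data.Fin.Properties as Fin
open import Data.List.Base using (List; []; _∷_; map; foldr)
open import Data.List.Relation.Unary.Unique.Propositional using (Unique)
open import Data.Nat.Base using (ℕ; zero; suc; _+_; _≤_; _⊓_; z≤n; s≤s)
open import Data.Product.Base using (∃; ∃-syntax; _×_; _,_; proj₁; proj₂)
open import Function.Definitions using (Injective)
open import Level using (0ℓ; _⊔_)
open import Relation.Binary.Core using (Rel)
open import Relation.Binary.Definitions using (Decidable; Symmetric)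
open import Relation.Binary.PropositionalEquality using (_≡_; refl)
open import Relation.Nullary using (¬_; Dec; yes; no; does; contradiction)
open import Relation.Nullary.Decidable using (map′; _×-dec_)
open import Relation.Unary using (Pred; _∈_)

record Graph (n : ℕ) : Set₁ where
  field
    Adj    : Rel (Fin n) 0ℓ
    adj?   : Decidable Adj
    symm   : Symmetric Adj
    irrefl : ∀ {i} → ¬ Adj i i

  infixr 5 _∷_

  data Walk : ℕ → Fin n → Fin n → Set where
    []  : ∀ {i} → Walk 0 i i
    _∷_ : ∀ {i j k m} → Adj i j → Walk m j k → Walk (suc m) i k

  vertices : ∀ {m i j} → Walk m i j → List (Fin n)
  vertices {i = i} []      = i ∷ []
  vertices {i = i} (_ ∷ w) = i ∷ vertices w

  Connected : Set
  Connected = ∀ i j → ∃[ m ] Walk m i j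

  -- A cycle is a path (a walk with distinct vertices) with at least two edges,
  -- closed up by one more edge joining its ends.
  Acyclic : Set
  Acyclic = ∀ {m i j} (w : Walk m i j) → 2 ≤ m → Unique (vertices w) → ¬ Adj j i

  IsDistance : Fin n → Fin n → ℕ → Set
  IsDistance i j m = Walk m i j × (∀ {k} → Walk k i j → m ≤ k)

  walk? : ∀ m i j → Dec (Walk m i j)
  walk? zero    i j = map′ (λ { refl → [] }) (λ { [] → refl }) (i Fin.≟ j)
  walk? (suc m) i k = map′ (λ { (_ , e , w) → e ∷ w }) (λ { (e ∷ w) → _ , e , w })
                           (Fin.any? (λ j → adj? i j ×-dec walk? m j k))

least : ∀ {P : Pred ℕ 0ℓ} → (∀ k → Dec (P k)) → ∀ m → P m →
        ∃[ m ] (P m × (∀ {k} → P k → m ≤ k))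
least P? zero    pm = 0 , pm , λ _ → z≤n
least {P} P? (suc m) pm with P? 0
... | yes p0 = 0 , p0 , λ _ → z≤n
... | no ¬p0 with least {λ k → P (suc k)} (λ k → P? (suc k)) m pm
...   | l , pl , minimal = suc l , pl , λ { {zero}  p0 → contradiction p0 ¬p0
                                          ; {suc k} pk → s≤s (minimal pk) }

record Tree (n : ℕ) : Set₁ where
  field
    graph     : Graph n
  open Graph graph public
  field
    connected : Connected
    acyclic   : Acyclic

  distance : ∀ i j → ∃ (IsDistance i j)
  distance i j = least (λ m → walk? m i j) (proj₁ (connected i j)) (proj₂ (connected i j))

  d : Fin n → Fin n → ℕ
  d i j = proj₁ (distance i j)

-- The set {i , j} is represented by its increasing listing, so that
-- propositional equality is equality of sets.
record 𝒱₂ (n : ℕ) : Set where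
  constructor pair
  field
    fst      : Fin n
    snd      : Fin n
    .fst<snd : fst Fin.< snd

Matrix : ∀ {a b} → Set a → Set b → Set (a ⊔ b)
Matrix I A = I → I → A

module _ {n} (T : Tree n) where
  open Tree T

  E : Pred (𝒱₂ n) 0ℓ
  E (pair i j _) = Adj i j

  dist : 𝒱₂ n → ℕ
  dist (pair i j _) = d i j

  Min4PC : Matrix (𝒱₂ n) ℕ
  Min4PC (pair i j _) (pair k l _) =
    ((d i l + d j k) ⊓ (d i k + d j l)) ⊓ (d i j + d k l)

record Enumerates {A : Set} {m : ℕ} (b : Fin m → A) (B : Pred A 0ℓ) : Set where
  field
    injective : Injective _≡_ _≡_ b
    sound     : ∀ k → b k ∈ B
    complete  : ∀ {x} → x ∈ B → ∃[ k ] b k ≡ x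

-- This is M[B,B] when b enumerates B.
principal : ∀ {I A : Set} {m} → Matrix I A → (Fin m → I) → Matrix (Fin m) A
principal M b r c = M (b r) (b c)

module Determinant {c ℓ} (R : RawRing c ℓ) where
  open RawRing R using (Carrier; 1#; -_; _*_; rawSemiring)
  open RawSemiringDefs rawSemiring using (sum; _^_)

  -- Laplace expansion along the first row.
  det : ∀ {m} → Matrix (Fin m) Carrier → Carrier
  det {zero}  A = 1#
  det {suc m} A = sum λ j →
    (- 1#) ^ toℕ j * A zero j * det (λ r c → A (suc r) (punchIn j c))

module Spectrum {c ℓ} (R : RawRing c ℓ) where
  open RawRing R renaming (_+_ to _⊕_; _*_ to _⊛_; -_ to ⊝_)

  -- Coefficient lists, constant term first; trailing zeros are allowed and
  -- are ignored by _≈ₚ_.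
  Poly : Set c
  Poly = List Carrier

  coeff : Poly → ℕ → Carrier
  coeff []      _       = 0#
  coeff (a ∷ p) zero    = a
  coeff (a ∷ p) (suc k) = coeff p k

  infix  4 _≈ₚ_
  infixl 6 _+ₚ_
  infixl 7 _*ₚ_

  _≈ₚ_ : Rel Poly ℓ
  p ≈ₚ q = ∀ k → coeff p k ≈ coeff q k

  _+ₚ_ : Poly → Poly → Poly
  []      +ₚ q       = q
  (a ∷ p) +ₚ []      = a ∷ p
  (a ∷ p) +ₚ (b ∷ q) = (a ⊕ b) ∷ (p +ₚ q)

  -ₚ_ : Poly → Poly
  -ₚ_ = map ⊝_

  _*ₚ_ : Poly → Poly → Poly
  []      *ₚ q = []
  (a ∷ p) *ₚ q = map (a ⊛_) q +ₚ (0# ∷ p *ₚ q)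

  constant : Carrier → Poly
  constant a = a ∷ []

  X : Poly
  X = 0# ∷ 1# ∷ []

  polyRing : RawRing c ℓ
  polyRing = record
    { Carrier = Poly ; _≈_ = _≈ₚ_ ; _+_ = _+ₚ_ ; _*_ = _*ₚ_
    ; -_ = -ₚ_ ; 0# = [] ; 1# = constant 1# }

  open RawSemiringDefs (RawRing.rawSemiring polyRing) public
    using () renaming (_^_ to _^ₚ_)

  -- det (X·I − A); the entry [] is the zero polynomial.
  charpoly : ∀ {m} → Matrix (Fin m) Carrier → Poly
  charpoly A = Determinant.det polyRing λ i j →
    (if does (i Fin.≟ j) then X else []) +ₚ (-ₚ constant (A i j))

  -- For a monic polynomial p: the roots of p, listed with multiplicity, are rs.
  HasRoots : Poly → List Carrier → Set ℓ
  HasRoots p rs = p ≈ₚ foldr (λ r q → (X +ₚ (-ₚ constant r)) *ₚ q) (constant 1#) rs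

  -- The eigenvalues of A, listed with (algebraic) multiplicity, are rs.
  HasEigenvalues : ∀ {m} → Matrix (Fin m) Carrier → List Carrier → Set ℓ
  HasEigenvalues A rs = HasRoots (charpoly A) rs

  open RawSemiringDefs rawSemiring using () renaming (_×_ to _·_; _^_ to _^ᶜ_)

  ι : ℕ → Carrier
  ι k = k · 1#

  fromℕ-matrix : ∀ {I : Set} → Matrix I ℕ → Matrix I Carrier
  fromℕ-matrix A i j = ι (A i j)

  -- x³ − (2n−6)x² − (nd²−5d²+2nd−2d+5n−9)x − 2(d−1)²(n−1), with n and d
  -- mapped into R before subtracting.
  g : ℕ → ℕ → Poly
  g n d = (⊝ (ι 2 ⊛ (D ⊕ ⊝ ι 1) ^ᶜ 2 ⊛ (N ⊕ ⊝ ι 1)))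
        ∷ (⊝ (N ⊛ D ^ᶜ 2 ⊕ ⊝ (ι 5 ⊛ D ^ᶜ 2) ⊕ ι 2 ⊛ N ⊛ D ⊕ ⊝ (ι 2 ⊛ D) ⊕ ι 5 ⊛ N ⊕ ⊝ ι 9))
        ∷ (⊝ (ι 2 ⊛ N ⊕ ⊝ ι 6))
        ∷ 1#
        ∷ []
    where
    N = ι n
    D = ι d

rawRing : ∀ {c ℓ₁ ℓ₂} → HeytingField c ℓ₁ ℓ₂ → RawRing c ℓ₁
rawRing K = CommutativeRing.rawRing
  (HeytingCommutativeRing.commutativeRing (HeytingField.heytingCommutativeRing K))

{-# OPTIONS --safe #-}
module Submission where

open import Defs
open import Algebra.Apartness.Bundles using (HeytingField; HeytingCommutativeRing)
open import Algebra.Bundles using (CommutativeRing; RawRing)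
open import Algebra.Morphism.Structures using (module RingMorphisms)
import Algebra.Properties.Group
import Algebra.Properties.Ring
import Algebra.Properties.Semiring.Exp
import Algebra.Properties.Semiring.Mult
import Algebra.Properties.Semiring.Mult.TCOptimised
import Algebra.Properties.Semiring.Sum
import Algebra.Solver.Ring
open import Algebra.Solver.Ring.AlmostCommutativeRing using (fromCommutativeRing; _-Raw-AlmostCommutative⟶_)
open import Data.Bool.Base using (true; false; if_then_else_)
open import Data.Empty.Irrelevant using () renaming (⊥-elim to ⊥-elim-irr)
open import Data.Fin.Base as Fin using (Fin; zero; suc; toℕ; fromℕ<; punchIn; inject₁; _↑ˡ_; _↑ʳ_)
open import Data.Fin.Permutation using (Permutation; permutation; ↔⇒≡)
open import Data.Fin.Properties as Fin using (_≟_; any?; injective⇒≤; punchInᵢ≢i; suc-injective; toℕ-fromℕ<; toℕ-inject₁; toℕ-injective; toℕ-↑ˡ; toℕ<n; toℕ≤n)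
open import Data.Integer.Base as ℤ using (ℤ; +_; -[1+_]; _⊖_)
import Data.Integer.Properties as ℤ
open import Data.List.Base using (List; []; _∷_; _++_; foldr; length; map; replicate)
open import Data.List.Membership.Propositional using () renaming (_∈_ to _∈ᴸ_)
open import Data.List.Relation.Unary.All as All using ([]; _∷_)
open import Data.List.Relation.Unary.All.Properties using (¬Any⇒All¬)
open import Data.List.Relation.Unary.AllPairs using ([]; _∷_)
open import Data.List.Relation.Unary.Any using (here; there)
open import Data.List.Relation.Unary.Unique.Propositional using (Unique)
import Data.Maybe.Base as Maybe
open import Data.Nat.Base as ℕ using (ℕ; zero; suc; _∸_; _≤_; _<_; z≤n; s≤s)
import Data.Nat.Properties as ℕ
open import Data.Product.Base using (∃; ∃-syntax; _×_; _,_; proj₁; proj₂)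
open import Data.Sum.Base using (_⊎_; inj₁; inj₂)
open import Function.Base using (_∘_; id; flip)
open import Relation.Binary.Definitions using (tri<; tri≈; tri>)
open import Relation.Binary.PropositionalEquality as ≡ using (_≡_; _≢_; cong; cong₂; subst; module ≡-Reasoning)
import Relation.Binary.Reasoning.Setoid
open import Relation.Nullary using (¬_; Dec; does; yes; no; contradiction)
open import Relation.Nullary.Decidable using (dec-true; dec-false)
open import Relation.Nullary.Decidable.Core using (dec⇒maybe)
open import Relation.Unary using (_∈_; _∪_; ｛_｝)

-- Root T at i. Every vertex v ≢ i stands for the edge joining it to its parent, and i for f, so B has n
-- elements. The entries of Min4PC[B,B] depend only on whether the two (distinct) indices are f, an edge of
-- the path between i and j, or another edge; and adding 2 to the diagonal makes that true of all entries.
-- Hence, with y = x + 2, the characteristic matrix is y I − W for a 3 × 3 block-constant W, and by Sylvester's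
-- identity y³ det (y I − W) = yⁿ det (y I − Q), where Q is the 3 × 3 quotient matrix for blocks of
-- sizes 1, d and n − 1 − d. The last determinant is g, and y can be cancelled since it is monic.

-- The entries are governed by one fact: for every choice of root, each edge joins a vertex to its
-- parent. It excludes triangles, so two distinct edges always give 2. It also separates the entries
-- d - 1 and d + 1 in the row of `f`: an edge whose ends exchange the roles of parent and child when
-- the root moves from i to j must lie on the path between them. Acyclicity speaks only of walks
-- without repeated vertices, so the fact is obtained by growing such walks until they close up.
-- Diagonal entries are 0, and the shift by 2, the value for distinct edges, is the source of the
-- eigenvalue -2. The polynomial ring has no division. Hence Sylvester's identity is reached by
-- bordering with one index per label, at the price of the factor y³, and the quotient matrix stays
-- unsymmetrised, with the block sizes as column weights. The sizes are counted as elements of the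
-- ring, where n - 1 - d is a genuine difference.

-- Ring identities with integer coefficients

module IntegerSolver {c ℓ} (R : CommutativeRing c ℓ) where
  open CommutativeRing R hiding (zero; rawRing)
  open Algebra.Properties.Ring ring
  open Algebra.Properties.Semiring.Mult.TCOptimised semiring using (1+×; ×-homo-+; ×1-homo-*)
    renaming (_×_ to _·_)
  open Relation.Binary.Reasoning.Setoid setoid

  -- The optimised multiple makes the images of 0 and 1 reduce to `0#` and `1#`, so integer
  -- constants in solver expressions match the goals without rewriting. Integers are the
  -- coefficients because their equality is decidable.
  fromℤ : ℤ → Carrier
  fromℤ (+ n)    = n · 1#
  fromℤ -[1+ n ] = - (suc n · 1#)

  fromℤ-⊖ : ∀ m n → fromℤ (m ⊖ n) ≈ m · 1# - n · 1#
  fromℤ-⊖ m zero = begin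
    m · 1#         ≈⟨ +-identityʳ _ ⟨
    m · 1# + 0#    ≈⟨ +-congˡ -0#≈0# ⟨
    m · 1# - 0#    ∎
  fromℤ-⊖ zero (suc n) = sym (+-identityˡ _)
  fromℤ-⊖ (suc m) (suc n) = begin
    fromℤ (suc m ⊖ suc n)              ≡⟨ cong fromℤ (ℤ.[1+m]⊖[1+n]≡m⊖n m n) ⟩
    fromℤ (m ⊖ n)                      ≈⟨ fromℤ-⊖ m n ⟩
    a - b                              ≈⟨ +-congʳ (+-identityʳ a) ⟨
    (a + 0#) - b                       ≈⟨ +-congʳ (+-congˡ (-‿inverseʳ 1#)) ⟨
    (a + (1# - 1#)) - b                ≈⟨ +-congʳ (+-assoc a 1# _) ⟨
    ((a + 1#) - 1#) - b                ≈⟨ +-assoc _ _ _ ⟩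
    (a + 1#) + (- 1# - b)              ≈⟨ +-cong (+-comm a 1#) (-‿+-comm 1# b) ⟩
    (1# + a) - (1# + b)                ≈⟨ +-cong (1+× m 1#) (-‿cong (1+× n 1#)) ⟨
    suc m · 1# - suc n · 1#            ∎
    where a = m · 1#
          b = n · 1#

  fromℤ-neg : ∀ i → fromℤ (ℤ.- i) ≈ - fromℤ i
  fromℤ-neg (+ zero)  = sym -0#≈0#
  fromℤ-neg (+ suc n) = refl
  fromℤ-neg -[1+ n ]  = sym (-‿involutive _)

  fromℤ-+ : ∀ i j → fromℤ (i ℤ.+ j) ≈ fromℤ i + fromℤ j
  fromℤ-+ (+ m)    (+ n)    = ×-homo-+ 1# m n
  fromℤ-+ (+ m)    -[1+ n ] = fromℤ-⊖ m (suc n)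
  fromℤ-+ -[1+ m ] (+ n)    = trans (fromℤ-⊖ n (suc m)) (+-comm _ _)
  fromℤ-+ -[1+ m ] -[1+ n ] = begin
    - (suc (suc (m ℕ.+ n)) · 1#)   ≡⟨ cong (λ k → - (k · 1#)) (ℕ.+-suc (suc m) n) ⟨
    - ((suc m ℕ.+ suc n) · 1#)     ≈⟨ -‿cong (×-homo-+ 1# (suc m) (suc n)) ⟩
    - (suc m · 1# + suc n · 1#)    ≈⟨ -‿+-comm _ _ ⟨
    - (suc m · 1#) - suc n · 1#    ∎

  fromℤ-+* : ∀ m j → fromℤ (+ m ℤ.* j) ≈ fromℤ (+ m) * fromℤ j
  fromℤ-+* m (+ n) = trans (reflexive (cong fromℤ (≡.sym (ℤ.pos-* m n)))) (×1-homo-* m n)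
  fromℤ-+* m -[1+ n ] = begin
    fromℤ (+ m ℤ.* (ℤ.- (+ suc n)))    ≡⟨ cong fromℤ (ℤ.neg-distribʳ-* (+ m) (+ suc n)) ⟨
    fromℤ (ℤ.- (+ m ℤ.* + suc n))      ≈⟨ fromℤ-neg (+ m ℤ.* + suc n) ⟩
    - fromℤ (+ m ℤ.* + suc n)          ≡⟨ cong (λ i → - fromℤ i) (ℤ.pos-* m (suc n)) ⟨
    - ((m ℕ.* suc n) · 1#)             ≈⟨ -‿cong (×1-homo-* m (suc n)) ⟩
    - (m · 1# * suc n · 1#)            ≈⟨ -‿distribʳ-* _ _ ⟩
    m · 1# * - (suc n · 1#)            ∎

  fromℤ-* : ∀ i j → fromℤ (i ℤ.* j) ≈ fromℤ i * fromℤ j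
  fromℤ-* (+ m)    j = fromℤ-+* m j
  fromℤ-* -[1+ m ] j = begin
    fromℤ (ℤ.- (+ suc m) ℤ.* j)      ≡⟨ cong fromℤ (ℤ.neg-distribˡ-* (+ suc m) j) ⟨
    fromℤ (ℤ.- (+ suc m ℤ.* j))      ≈⟨ fromℤ-neg (+ suc m ℤ.* j) ⟩
    - fromℤ (+ suc m ℤ.* j)          ≈⟨ -‿cong (fromℤ-+* (suc m) j) ⟩
    - (suc m · 1# * fromℤ j)         ≈⟨ -‿distribˡ-* _ _ ⟩
    - (suc m · 1#) * fromℤ j         ∎

  morphism : ℤ.+-*-rawRing -Raw-AlmostCommutative⟶ fromCommutativeRing R
  morphism = record
    { ⟦_⟧ = fromℤ ; +-homo = fromℤ-+ ; *-homo = fromℤ-* ; -‿homo = fromℤ-neg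
    ; 0-homo = refl ; 1-homo = refl }

  open Algebra.Solver.Ring ℤ.+-*-rawRing (fromCommutativeRing R) morphism
    (λ i j → Maybe.map (reflexive ∘ cong fromℤ) (dec⇒maybe (i ℤ.≟ j))) public
    using (Polynomial; solve; con; _:=_; _:+_; _:*_; _:-_; :-_)

  -- Lets one function both build the formal expression of a determinant and compute its value.
  expressions : ℕ → RawRing _ _
  expressions n = record
    { Carrier = Polynomial n ; _≈_ = _≡_ ; _+_ = _:+_ ; _*_ = _:*_ ; -_ = :-_ ; 0# = con (+ 0) ; 1# = con (+ 1) }

-- Determinants over a commutative ring, and Sylvester's identity for block-constant matrices

module DeterminantProperties {c ℓ} (R : CommutativeRing c ℓ) where
  open CommutativeRing R hiding (zero; rawRing)
  open Algebra.Properties.Ring ring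
  open Algebra.Properties.Semiring.Exp semiring using (_^_)
  open Algebra.Properties.Semiring.Sum semiring
  open Relation.Binary.Reasoning.Setoid setoid
  open Determinant (CommutativeRing.rawRing R) public
  open IntegerSolver R

  private
    Mat : ℕ → Set c
    Mat m = Matrix (Fin m) Carrier

  sign : ∀ {m} → Fin m → Carrier
  sign j = (- 1#) ^ toℕ j

  sum-zero : ∀ {m} {t : Fin m → Carrier} → (∀ i → t i ≈ 0#) → sum t ≈ 0#
  sum-zero {m} t≈0 = trans (sum-cong-≋ t≈0) (sum-replicate-zero m)

  sum-↑ : ∀ m {q} (t : Fin (m ℕ.+ q) → Carrier) →
          sum t ≈ sum (λ i → t (i ↑ˡ q)) + sum (λ i → t (m ↑ʳ i))
  sum-↑ zero    t = sym (+-identityˡ _)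
  sum-↑ (suc m) t = trans (+-congˡ (sum-↑ m (t ∘ suc))) (sym (+-assoc _ _ _))

  det-cong : ∀ {m} (A B : Mat m) → (∀ r c → A r c ≈ B r c) → det A ≈ det B
  det-cong {zero}  A B A≈B = refl
  det-cong {suc m} A B A≈B = sum-cong-≋ λ j →
    *-cong (*-congˡ {sign j} (A≈B zero j))
           (det-cong (minor A j) (minor B j) λ r c → A≈B (suc r) (punchIn j c))
    where
    minor : Mat (suc m) → Fin (suc m) → Mat m
    minor A j r c = A (suc r) (punchIn j c)

  -- The corner terms of both expansions agree. In the rest, each minor is expanded along its first
  -- column by induction; the resulting double sum runs over minors with two rows and two columns
  -- deleted and is symmetric, so exchanging the sums gives the column expansion.
  det-expand-col₀ : ∀ {m} (A : Mat (suc m)) →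
    det A ≈ sum λ i → sign i * A i zero * det (λ r c → A (punchIn i r) (suc c))
  det-expand-col₀ {zero}  A = refl
  det-expand-col₀ {suc m} A = +-congˡ (begin
    sum (λ j → a j * det (λ r c → A (suc r) (punchIn (suc j) c)))
      ≈⟨ sum-cong-≋ (λ j → *-congˡ {a j} (det-expand-col₀ λ r c → A (suc r) (punchIn (suc j) c))) ⟩
    sum (λ j → a j * sum λ i → sign i * A (suc i) zero * D i j)
      ≈⟨ sum-cong-≋ (λ j → *-distribˡ-sum (a j) λ i → sign i * A (suc i) zero * D i j) ⟩
    sum (λ j → sum λ i → a j * (sign i * A (suc i) zero * D i j))
      ≈⟨ ∑-comm (λ j i → a j * (sign i * A (suc i) zero * D i j)) ⟩
    sum (λ i → sum λ j → a j * (sign i * A (suc i) zero * D i j))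
      ≈⟨ sum-cong-≋ (λ i → sum-cong-≋ λ j → shuffle (sign j) (A zero (suc j)) (sign i) (A (suc i) zero) (D i j)) ⟩
    sum (λ i → sum λ j → b i * (sign j * A zero (suc j) * D i j))
      ≈⟨ sum-cong-≋ (λ i → *-distribˡ-sum (b i) λ j → sign j * A zero (suc j) * D i j) ⟨
    sum (λ i → b i * det (λ r c → A (punchIn (suc i) r) (suc c))) ∎)
    where
    D : Fin (suc m) → Fin (suc m) → Carrier
    D i j = det (λ r c → A (suc (punchIn i r)) (suc (punchIn j c)))
    a b : Fin (suc m) → Carrier
    a j = sign (suc j) * A zero (suc j)
    b i = sign (suc i) * A (suc i) zero
    shuffle : ∀ s x t y z → - 1# * s * x * (t * y * z) ≈ - 1# * t * y * (s * x * z)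
    shuffle s x t y z = solve 6 (λ e s x t y z → e :* s :* x :* (t :* y :* z) := e :* t :* y :* (s :* x :* z))
      refl (- 1#) s x t y z

  det-transpose : ∀ {m} (A : Mat m) → det (flip A) ≈ det A
  det-transpose {zero}  A = refl
  det-transpose {suc m} A = trans
    (sum-cong-≋ λ j → *-congˡ {sign j * A j zero} (det-transpose λ r c → A (punchIn j r) (suc c)))
    (sym (det-expand-col₀ A))

  swap : ∀ {m} → Fin m → Fin (suc m) → Fin (suc m)
  swap zero    zero          = suc zero
  swap zero    (suc zero)    = zero
  swap zero    (suc (suc c)) = suc (suc c)
  swap (suc k) zero          = zero
  swap (suc k) (suc c)       = suc (swap k c)

  swap-inject₁ : ∀ {m} (k : Fin m) → swap k (inject₁ k) ≡ suc k
  swap-inject₁ zero    = ≡.refl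
  swap-inject₁ (suc k) = cong suc (swap-inject₁ k)

  -- For the first two columns, the first two terms of the row expansion trade places and the
  -- remaining minors still contain both columns, so induction applies to them. Any later adjacent
  -- pair leaves column 0 in place, and expansion along that column reduces to smaller matrices.
  det-swap-cols : ∀ {m} (k : Fin m) (A : Mat (suc m)) →
                  det (λ r c → A r (swap k c)) ≈ - 1# * det A
  det-swap-cols {suc m} zero A = begin
    1# * A zero (suc zero) * det (λ r c → A (suc r) (swap zero (suc c)))
      + (- 1# * 1# * A zero zero * det (λ r c → A (suc r) (swap zero (punchIn (suc zero) c))) + sum S)
      ≈⟨ +-cong (*-congˡ (det-cong (λ r c → B (suc r) (suc c)) M₁ λ { r zero → refl ; r (suc c) → refl }))
                (+-cong (*-congˡ (det-cong (λ r c → B (suc r) (punchIn (suc zero) c)) M₀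
                                           λ { r zero → refl ; r (suc c) → refl }))
                        (trans (sum-cong-≋ (tail A)) (sym (*-distribˡ-sum (- 1#) T)))) ⟩
    1# * A zero (suc zero) * d₁ + (- 1# * 1# * A zero zero * d₀ + - 1# * sum T)
      ≈⟨ solve 5 (λ x y p q t → con (+ 1) :* y :* q :+ (:- con (+ 1) :* con (+ 1) :* x :* p :+ :- con (+ 1) :* t)
            := :- con (+ 1) :* (con (+ 1) :* x :* p :+ (:- con (+ 1) :* con (+ 1) :* y :* q :+ t)))
          refl (A zero zero) (A zero (suc zero)) d₀ d₁ (sum T) ⟩
    - 1# * det A ∎
    where
    B : Mat (suc (suc m))
    B r c = A r (swap zero c)
    M₀ M₁ : Mat (suc m)
    M₀ r c = A (suc r) (suc c)
    M₁ r c = A (suc r) (punchIn (suc zero) c)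
    d₀ = det M₀
    d₁ = det M₁
    S T : Fin m → Carrier
    S j = sign (suc (suc j)) * A zero (suc (suc j)) * det (λ r c → A (suc r) (swap zero (punchIn (suc (suc j)) c)))
    T j = sign (suc (suc j)) * A zero (suc (suc j)) * det (λ r c → A (suc r) (punchIn (suc (suc j)) c))
    tail : ∀ {m} (A : Mat (suc (suc m))) (j : Fin m) →
      sign (suc (suc j)) * A zero (suc (suc j)) * det (λ r c → A (suc r) (swap zero (punchIn (suc (suc j)) c)))
      ≈ - 1# * (sign (suc (suc j)) * A zero (suc (suc j)) * det (λ r c → A (suc r) (punchIn (suc (suc j)) c)))
    tail {suc m} A j = trans
      (*-congˡ (trans (det-cong (λ r c → A (suc r) (swap zero (punchIn (suc (suc j)) c))) (λ r c → M r (swap zero c))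
                         λ { r zero → refl ; r (suc zero) → refl ; r (suc (suc c)) → refl })
                      (det-swap-cols zero M)))
      (solve 2 (λ s d → s :* (:- con (+ 1) :* d) := :- con (+ 1) :* (s :* d)) refl _ (det M))
      where
      M : Mat (suc (suc m))
      M r c = A (suc r) (punchIn (suc (suc j)) c)
  det-swap-cols (suc k) A = begin
    det (λ r c → A r (swap (suc k) c))
      ≈⟨ det-expand-col₀ (λ r c → A r (swap (suc k) c)) ⟩
    sum (λ i → sign i * A i zero * det (λ r c → A (punchIn i r) (suc (swap k c))))
      ≈⟨ sum-cong-≋ (λ i → *-congˡ {sign i * A i zero} (det-swap-cols k λ r c → A (punchIn i r) (suc c))) ⟩
    sum (λ i → sign i * A i zero * (- 1# * D i))
      ≈⟨ sum-cong-≋ (λ i → solve 3 (λ e s d → s :* (e :* d) := e :* (s :* d)) refl (- 1#) (sign i * A i zero) (D i)) ⟩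
    sum (λ i → - 1# * (sign i * A i zero * D i))
      ≈⟨ *-distribˡ-sum (- 1#) (λ i → sign i * A i zero * D i) ⟨
    - 1# * sum (λ i → sign i * A i zero * D i)
      ≈⟨ *-congˡ (det-expand-col₀ A) ⟨
    - 1# * det A ∎
    where
    D : Fin _ → Carrier
    D i = det (λ r c → A (punchIn i r) (suc c))

  -- Antisymmetry would only give 2 det A = 0, which is too weak in characteristic 2. The row
  -- expansion is therefore used directly: its first two terms cancel and the other minors inherit
  -- the equal columns.
  det-equal-cols₀₁ : ∀ {m} (A : Mat (suc (suc m))) → (∀ r → A r zero ≈ A r (suc zero)) → det A ≈ 0#
  det-equal-cols₀₁ {m} A A₀≈A₁ = begin
    1# * A zero zero * d₀ + (- 1# * 1# * A zero (suc zero) * d₁ + sum T)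
      ≈⟨ +-cong (*-cong (*-congˡ (A₀≈A₁ zero)) (det-cong M₀ M₁ λ { r zero → sym (A₀≈A₁ (suc r)) ; r (suc c) → refl }))
                (+-congˡ (sum-zero (tail A A₀≈A₁))) ⟩
    1# * A zero (suc zero) * d₁ + (- 1# * 1# * A zero (suc zero) * d₁ + 0#)
      ≈⟨ solve 2 (λ x d → con (+ 1) :* x :* d :+ (:- con (+ 1) :* con (+ 1) :* x :* d :+ con (+ 0)) := con (+ 0))
           refl (A zero (suc zero)) d₁ ⟩
    0# ∎
    where
    M₀ M₁ : Mat (suc m)
    M₀ r c = A (suc r) (suc c)
    M₁ r c = A (suc r) (punchIn (suc zero) c)
    d₀ = det M₀
    d₁ = det M₁
    T : Fin m → Carrier
    T j = sign (suc (suc j)) * A zero (suc (suc j)) * det (λ r c → A (suc r) (punchIn (suc (suc j)) c))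
    tail : ∀ {m} (A : Mat (suc (suc m))) → (∀ r → A r zero ≈ A r (suc zero)) → (j : Fin m) →
      sign (suc (suc j)) * A zero (suc (suc j)) * det (λ r c → A (suc r) (punchIn (suc (suc j)) c)) ≈ 0#
    tail {suc m} A A₀≈A₁ j = trans
      (*-congˡ (det-equal-cols₀₁ (λ r c → A (suc r) (punchIn (suc (suc j)) c)) (A₀≈A₁ ∘ suc))) (zeroʳ _)

  -- Adjacent swaps carry the second copy leftwards until it stands next to column 0. The recursion
  -- is on the numerical position because `inject₁ j` is not a structural subterm.
  det-equal-cols : ∀ {m} (j : Fin m) (A : Mat (suc m)) → (∀ r → A r zero ≈ A r (suc j)) → det A ≈ 0#
  det-equal-cols j = go (toℕ j) j ≡.refl
    where
    go : ∀ t {m} (j : Fin m) → toℕ j ≡ t → (A : Mat (suc m)) → (∀ r → A r zero ≈ A r (suc j)) → det A ≈ 0#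
    go t       zero    eq A A₀≈Aⱼ = det-equal-cols₀₁ A A₀≈Aⱼ
    go (suc t) (suc j) eq A A₀≈Aⱼ = begin
      det A                       ≈⟨ solve 1 (λ d → d := :- con (+ 1) :* (:- con (+ 1) :* d)) refl (det A) ⟩
      - 1# * (- 1# * det A)       ≈⟨ *-congˡ (det-swap-cols (suc j) A) ⟨
      - 1# * det B                ≈⟨ *-congˡ (go t (inject₁ j) (≡.trans (toℕ-inject₁ j) (ℕ.suc-injective eq)) B
                                        λ r → trans (A₀≈Aⱼ r) (reflexive (cong (A r ∘ suc) (≡.sym (swap-inject₁ j))))) ⟩
      - 1# * 0#                   ≈⟨ zeroʳ _ ⟩
      0#                          ∎
      where B = λ r c → A r (swap (suc j) c)

  det-col-+ : ∀ {m} (k : Fin m) (A B C : Mat m) → (∀ r → C r k ≈ A r k + B r k) →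
              (∀ r c → c ≢ k → C r c ≈ A r c) → (∀ r c → c ≢ k → C r c ≈ B r c) → det C ≈ det A + det B
  det-col-+ {suc m} k A B C C≈A+B C≈A C≈B = begin
    det C                               ≈⟨ det-expand-col₀ C ⟩
    sum (λ i → term C i)                ≈⟨ sum-cong-≋ (step k C≈A+B C≈A C≈B) ⟩
    sum (λ i → term A i + term B i)     ≈⟨ ∑-distrib-+ (term A) (term B) ⟩
    sum (term A) + sum (term B)         ≈⟨ +-cong (det-expand-col₀ A) (det-expand-col₀ B) ⟨
    det A + det B                       ∎
    where
    minor : Fin (suc m) → Mat (suc m) → Mat m
    minor i M r c = M (punchIn i r) (suc c)
    term : Mat (suc m) → Fin (suc m) → Carrier
    term M i = sign i * M i zero * det (minor i M)
    step : ∀ k → (∀ r → C r k ≈ A r k + B r k) → (∀ r c → c ≢ k → C r c ≈ A r c) →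
           (∀ r c → c ≢ k → C r c ≈ B r c) → ∀ i → term C i ≈ term A i + term B i
    step zero C≈A+B C≈A C≈B i = begin
      term C i
        ≈⟨ *-congʳ (*-congˡ (C≈A+B i)) ⟩
      sign i * (A i zero + B i zero) * det (minor i C)
        ≈⟨ solve 4 (λ s a b d → s :* (a :+ b) :* d := s :* a :* d :+ s :* b :* d) refl _ _ _ _ ⟩
      sign i * A i zero * det (minor i C) + sign i * B i zero * det (minor i C)
        ≈⟨ +-cong (*-congˡ (det-cong (minor i C) (minor i A) λ r c → C≈A _ _ λ ()))
                  (*-congˡ (det-cong (minor i C) (minor i B) λ r c → C≈B _ _ λ ())) ⟩
      term A i + term B i ∎
    step (suc k) C≈A+B C≈A C≈B i = begin
      sign i * C i zero * det (minor i C)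
        ≈⟨ *-congˡ (det-col-+ k (minor i A) (minor i B) (minor i C) (λ r → C≈A+B _)
                      (λ r c c≢k → C≈A _ _ (c≢k ∘ suc-injective)) (λ r c c≢k → C≈B _ _ (c≢k ∘ suc-injective))) ⟩
      sign i * C i zero * (det (minor i A) + det (minor i B))
        ≈⟨ distribˡ _ _ _ ⟩
      sign i * C i zero * det (minor i A) + sign i * C i zero * det (minor i B)
        ≈⟨ +-cong (*-congʳ (*-congˡ (C≈A i zero λ ()))) (*-congʳ (*-congˡ (C≈B i zero λ ()))) ⟩
      term A i + term B i ∎

  det-row₀ : ∀ {m} (A : Mat (suc m)) {y} → A zero zero ≈ y → (∀ c → A zero (suc c) ≈ 0#) →
             det A ≈ y * det (λ r c → A (suc r) (suc c))
  det-row₀ A {y} A₀₀≈y A₀≈0 = begin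
    1# * A zero zero * D + sum S   ≈⟨ +-cong (*-congʳ (*-congˡ A₀₀≈y))
                                        (sum-zero λ j → trans (*-congʳ (trans (*-congˡ (A₀≈0 j)) (zeroʳ _))) (zeroˡ _)) ⟩
    1# * y * D + 0#                ≈⟨ +-identityʳ _ ⟩
    1# * y * D                     ≈⟨ *-congʳ (*-identityˡ y) ⟩
    y * D                          ∎
    where
    D = det (λ r c → A (suc r) (suc c))
    S : Fin _ → Carrier
    S j = sign (suc j) * A zero (suc j) * det (λ r c → A (suc r) (punchIn (suc j) c))

  scalar : Carrier → ∀ {m} → Mat m
  scalar y r c = if does (r ≟ c) then y else 0#

  det-scalar : ∀ y m → det (scalar y {m}) ≈ y ^ m
  det-scalar y zero    = refl
  det-scalar y (suc m) = trans (det-row₀ {m} (scalar y) {y} refl (λ _ → refl)) (*-congˡ (det-scalar y m))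

  punchIn-↑ˡ : ∀ {m} q (j : Fin (suc m)) (c : Fin m) → punchIn (j ↑ˡ q) (c ↑ˡ q) ≡ punchIn j c ↑ˡ q
  punchIn-↑ˡ q zero    c       = ≡.refl
  punchIn-↑ˡ q (suc j) zero    = ≡.refl
  punchIn-↑ˡ q (suc j) (suc c) = cong suc (punchIn-↑ˡ q j c)

  punchIn-↑ʳ : ∀ {m} {q} (j : Fin (suc m)) (t : Fin q) → punchIn (j ↑ˡ q) (m ↑ʳ t) ≡ suc (m ↑ʳ t)
  punchIn-↑ʳ         zero    t = ≡.refl
  punchIn-↑ʳ {suc m} (suc j) t = cong suc (punchIn-↑ʳ j t)

  -- The border columns vanish in row 0, so only the first columns contribute to its expansion, and
  -- each minor has the same block shape.
  det-block : ∀ y {m} q (A : Mat (m ℕ.+ q)) → (∀ r t → A r (m ↑ʳ t) ≈ scalar y r (m ↑ʳ t)) →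
              det A ≈ det (λ r c → A (r ↑ˡ q) (c ↑ˡ q)) * y ^ q
  det-block y {zero}  q A A≈y = trans (trans (det-cong A (scalar y) A≈y) (det-scalar y q)) (sym (*-identityˡ _))
  det-block y {suc m} q A A≈y = begin
    sum S
      ≈⟨ sum-↑ (suc m) S ⟩
    sum (λ j → S (j ↑ˡ q)) + sum (λ t → S (suc m ↑ʳ t))
      ≈⟨ +-cong (sum-cong-≋ left) (sum-zero λ t → trans (*-congʳ (trans (*-congˡ (A≈y zero t)) (zeroʳ _))) (zeroˡ _)) ⟩
    sum (λ j → T j * y ^ q) + 0#
      ≈⟨ +-identityʳ _ ⟩
    sum (λ j → T j * y ^ q)
      ≈⟨ *-distribʳ-sum (y ^ q) T ⟨
    sum T * y ^ q ∎
    where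
    S : Fin (suc m ℕ.+ q) → Carrier
    S j = sign j * A zero j * det (λ r c → A (suc r) (punchIn j c))
    T : Fin (suc m) → Carrier
    T j = sign j * A zero (j ↑ˡ q) * det (λ r c → A (suc (r ↑ˡ q)) (punchIn j c ↑ˡ q))
    left : ∀ j → S (j ↑ˡ q) ≈ T j * y ^ q
    left j = begin
      S (j ↑ˡ q)
        ≈⟨ *-cong (*-congʳ (reflexive (cong ((- 1#) ^_) (toℕ-↑ˡ j q))))
             (det-block y q (λ r c → A (suc r) (punchIn (j ↑ˡ q) c)) λ r t →
                trans (reflexive (cong (A (suc r)) (punchIn-↑ʳ j t))) (A≈y (suc r) t)) ⟩
      sign j * A zero (j ↑ˡ q) * (det (λ r c → A (suc (r ↑ˡ q)) (punchIn (j ↑ˡ q) (c ↑ˡ q))) * y ^ q)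
        ≈⟨ *-congˡ (*-congʳ (det-cong _ (λ r c → A (suc (r ↑ˡ q)) (punchIn j c ↑ˡ q)) λ r c →
             reflexive (cong (A (suc (r ↑ˡ q))) (punchIn-↑ˡ q j c)))) ⟩
      sign j * A zero (j ↑ˡ q) * (det (λ r c → A (suc (r ↑ˡ q)) (punchIn j c ↑ˡ q)) * y ^ q)
        ≈⟨ *-assoc _ _ _ ⟨
      T j * y ^ q ∎

  -- The matrix y I - W diag(k), with W given by labels. The weight `k c` counts the original
  -- indices merged into column c: weight 1 is an unmerged index, and a column of weight 0 is a
  -- column of y I.
  weighted : ∀ {L : Set} → Carrier → (L → L → Carrier) → ∀ {m} → (Fin m → L) → (Fin m → Carrier) → Mat m
  weighted y w l k r c = scalar y r c - w (l r) (l c) * k c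

  module _ {L : Set} (y : Carrier) (w : L → L → Carrier) where

    -- Subtract row j from row 0, then add column 0 to column j.
    det-merge : ∀ {m} (l : Fin (suc m) → L) (k : Fin (suc m) → Carrier) (k′ : Fin m → Carrier) (j : Fin m) →
      l zero ≡ l (suc j) → k′ j ≈ k (suc j) + k zero → (∀ c → c ≢ j → k′ c ≈ k (suc c)) →
      det (weighted y w l k) ≈ y * det (weighted y w (l ∘ suc) k′)
    det-merge {m} l k k′ j l₀≡lⱼ k′ⱼ k′-rest = begin
      det A           ≈⟨ det-transpose A ⟨
      det (flip A)    ≈⟨ det-col-+ zero (flip B) (flip A′) (flip A) A₀-split
                           (λ { _ zero 0≢0 → contradiction ≡.refl 0≢0 ; _ (suc _) _ → refl })
                           (λ { _ zero 0≢0 → contradiction ≡.refl 0≢0 ; _ (suc _) _ → refl }) ⟩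
      det (flip B) + det (flip A′)
                      ≈⟨ +-cong (det-transpose B) (det-equal-cols j (flip A′) λ r → refl) ⟩
      det B + 0#      ≈⟨ +-congˡ (det-equal-cols j B′ B′-equal) ⟨
      det B + det B′  ≈⟨ det-col-+ (suc j) B B′ C C-split C≈B C≈B′ ⟨
      det C           ≈⟨ det-row₀ C {y} refl (λ _ → refl) ⟩
      y * det (weighted y w (l ∘ suc) k′) ∎
      where
      -- `A` is `B` plus `A′` in row 0, and `A′` repeats row `suc j` there, so `A` and `B` have
      -- equal determinants. `C` is `B` plus `B′` in column `suc j`, and `B′` repeats column 0
      -- there, so `B` and `C` have equal determinants. Row 0 of `C` is y followed by zeros.
      A A′ B B′ C : Mat (suc m)
      A = weighted y w l k
      A′ zero    c = A (suc j) c
      A′ (suc r) c = A (suc r) c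
      B zero    zero    = y
      B zero    (suc c) = - scalar y j c
      B (suc r) c       = A (suc r) c
      B′ r zero    = B r zero
      B′ r (suc c) = if does (j ≟ c) then B r zero else B r (suc c)
      C zero    zero    = y
      C zero    (suc c) = 0#
      C (suc r) zero    = A (suc r) zero
      C (suc r) (suc c) = weighted y w (l ∘ suc) k′ r c

      A₀-split : ∀ c → A zero c ≈ B zero c + A (suc j) c
      A₀-split zero rewrite l₀≡lⱼ = solve 2 (λ y p → y :- p := y :+ (con (+ 0) :- p)) refl y _
      A₀-split (suc c) rewrite l₀≡lⱼ =
        solve 2 (λ s p → con (+ 0) :- p := :- s :+ (s :- p)) refl (scalar y j c) _

      B′-equal : ∀ r → B′ r zero ≈ B′ r (suc j)
      B′-equal r rewrite dec-true (j ≟ j) ≡.refl = refl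

      C-split : ∀ r → C r (suc j) ≈ B r (suc j) + B′ r (suc j)
      C-split zero rewrite dec-true (j ≟ j) ≡.refl = sym (-‿inverseˡ y)
      C-split (suc r) rewrite dec-true (j ≟ j) ≡.refl | l₀≡lⱼ =
        trans (+-congˡ (-‿cong (*-congˡ k′ⱼ)))
          (solve 4 (λ s w a b → s :- w :* (a :+ b) := (s :- w :* a) :+ (con (+ 0) :- w :* b)) refl
            (scalar y r j) (w (l (suc r)) (l (suc j))) (k (suc j)) (k zero))

      C≈B : ∀ r c → c ≢ suc j → C r c ≈ B r c
      C≈B zero    zero    _ = refl
      C≈B (suc r) zero    _ = refl
      C≈B zero    (suc c) c≢j rewrite dec-false (j ≟ c) (λ j≡c → c≢j (cong suc (≡.sym j≡c))) = sym -0#≈0#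
      C≈B (suc r) (suc c) c≢j = +-congˡ (-‿cong (*-congˡ (k′-rest c (c≢j ∘ cong suc))))

      C≈B′ : ∀ r c → c ≢ suc j → C r c ≈ B′ r c
      C≈B′ zero    zero    _ = refl
      C≈B′ (suc r) zero    _ = refl
      C≈B′ r       (suc c) c≢j with C≈B r (suc c) c≢j
      ... | C≈B rewrite dec-false (j ≟ c) (λ j≡c → c≢j (cong suc (≡.sym j≡c))) = C≈B

  indicator : ∀ {q} → Fin q → Fin q → Carrier
  indicator s t = if does (s ≟ t) then 1# else 0#

  count : ∀ {m q} → (Fin m → Fin q) → Fin q → Carrier
  count l t = sum λ r → indicator (l r) t

  module _ {q} (y : Carrier) (w : Fin q → Fin q → Carrier) where

    private
      labels : ∀ {m} → (Fin m → Fin q) → Fin (m ℕ.+ q) → Fin q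
      labels {zero}  l t       = t
      labels {suc m} l zero    = l zero
      labels {suc m} l (suc r) = labels (l ∘ suc) r

      weights : ∀ m → (Fin q → Carrier) → Fin (m ℕ.+ q) → Carrier
      weights zero    a t       = a t
      weights (suc m) a zero    = 1#
      weights (suc m) a (suc r) = weights m a r

      labels-↑ˡ : ∀ {m} (l : Fin m → Fin q) r → labels l (r ↑ˡ q) ≡ l r
      labels-↑ˡ l zero    = ≡.refl
      labels-↑ˡ l (suc r) = labels-↑ˡ (l ∘ suc) r

      labels-↑ʳ : ∀ {m} (l : Fin m → Fin q) t → labels l (m ↑ʳ t) ≡ t
      labels-↑ʳ {zero}  l t = ≡.refl
      labels-↑ʳ {suc m} l t = labels-↑ʳ (l ∘ suc) t

      weights-↑ˡ : ∀ {m} a (r : Fin m) → weights m a (r ↑ˡ q) ≡ 1#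
      weights-↑ˡ a zero    = ≡.refl
      weights-↑ˡ a (suc r) = weights-↑ˡ a r

      weights-↑ʳ : ∀ m a t → weights m a (m ↑ʳ t) ≡ a t
      weights-↑ʳ zero    a t = ≡.refl
      weights-↑ʳ (suc m) a t = weights-↑ʳ m a t

      weights-rest : ∀ m a b t → (∀ s → s ≢ t → a s ≈ b s) → ∀ r → r ≢ m ↑ʳ t → weights m a r ≈ weights m b r
      weights-rest zero    a b t a≈b r       r≢t = a≈b r r≢t
      weights-rest (suc m) a b t a≈b zero    r≢t = refl
      weights-rest (suc m) a b t a≈b (suc r) r≢t = weights-rest m a b t a≈b r (r≢t ∘ cong suc)

      -- Each merge sends the first remaining index into the border index with its label, extracts
      -- one factor y and raises that border weight by 1. The accumulator `a` makes the induction go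
      -- through.
      det-accumulate : ∀ {m} (l : Fin m → Fin q) a →
        det (weighted y w (labels l) (weights m a)) ≈ y ^ m * det (weighted y w id (λ t → a t + count l t))
      det-accumulate {zero} l a = trans
        (det-cong (weighted y w id a) (weighted y w id (λ t → a t + 0#)) λ r c →
          +-congˡ {scalar y r c} (-‿cong (*-congˡ (sym (+-identityʳ (a c))))))
        (sym (*-identityˡ _))
      det-accumulate {suc m} l a = begin
        det (weighted y w (labels l) (weights (suc m) a))
          ≈⟨ det-merge y w (labels l) (weights (suc m) a) (weights m a′) (m ↑ʳ l zero)
               (≡.sym (labels-↑ʳ (l ∘ suc) (l zero))) merged
               (λ r r≢ → weights-rest m a′ a (l zero) rest r r≢) ⟩
        y * det (weighted y w (labels (l ∘ suc)) (weights m a′))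
          ≈⟨ *-congˡ (det-accumulate (l ∘ suc) a′) ⟩
        y * (y ^ m * det (weighted y w id (λ t → a′ t + count (l ∘ suc) t)))
          ≈⟨ *-assoc _ _ _ ⟨
        y ^ suc m * det (weighted y w id (λ t → a′ t + count (l ∘ suc) t))
          ≈⟨ *-congˡ (det-cong (weighted y w id _) (weighted y w id _) λ r c →
               +-congˡ {scalar y r c} (-‿cong (*-congˡ (+-assoc (a c) _ _)))) ⟩
        y ^ suc m * det (weighted y w id (λ t → a t + count l t)) ∎
        where
        a′ : Fin q → Carrier
        a′ t = a t + indicator (l zero) t
        merged : weights m a′ (m ↑ʳ l zero) ≈ weights m a (m ↑ʳ l zero) + 1#
        merged rewrite weights-↑ʳ m a′ (l zero) | weights-↑ʳ m a (l zero) | dec-true (l zero ≟ l zero) ≡.refl = refl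
        rest : ∀ s → s ≢ l zero → a′ s ≈ a s
        rest s s≢l₀ rewrite dec-false (l zero ≟ s) (s≢l₀ ∘ ≡.sym) = +-identityʳ (a s)

    -- Border the matrix by one index of weight 0 for every label (which only contributes y ^ q),
    -- then merge all original indices into these.
    det-blowup : ∀ {m} (l : Fin m → Fin q) →
      y ^ q * det (λ r c → scalar y r c - w (l r) (l c)) ≈ y ^ m * det (weighted y w id (count l))
    det-blowup {m} l = begin
      y ^ q * det (λ r c → scalar y r c - w (l r) (l c))
        ≈⟨ *-comm _ _ ⟩
      det (λ r c → scalar y r c - w (l r) (l c)) * y ^ q
        ≈⟨ *-congʳ (det-cong _ (λ r c → scalar y r c - w (l r) (l c)) restrict) ⟨
      det (λ r c → A (r ↑ˡ q) (c ↑ˡ q)) * y ^ q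
        ≈⟨ det-block y q A A-border ⟨
      det A
        ≈⟨ det-accumulate l (λ _ → 0#) ⟩
      y ^ m * det (weighted y w id (λ t → 0# + count l t))
        ≈⟨ *-congˡ (det-cong (weighted y w id _) (weighted y w id _) λ r c →
               +-congˡ {scalar y r c} (-‿cong (*-congˡ (+-identityˡ (count l c))))) ⟩
      y ^ m * det (weighted y w id (count l)) ∎
      where
      A : Mat (m ℕ.+ q)
      A = weighted y w (labels l) (weights m (λ _ → 0#))
      A-border : ∀ r t → A r (m ↑ʳ t) ≈ scalar y r (m ↑ʳ t)
      A-border r t rewrite weights-↑ʳ m (λ _ → 0#) t = solve 2 (λ s w → s :- w :* con (+ 0) := s) refl _ _
      scalar-↑ˡ : ∀ {m} (r c : Fin m) → scalar y (r ↑ˡ q) (c ↑ˡ q) ≡ scalar y r c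
      scalar-↑ˡ zero    zero    = ≡.refl
      scalar-↑ˡ zero    (suc c) = ≡.refl
      scalar-↑ˡ (suc r) zero    = ≡.refl
      scalar-↑ˡ (suc r) (suc c) = scalar-↑ˡ r c
      restrict : ∀ r c → A (r ↑ˡ q) (c ↑ˡ q) ≈ scalar y r c - w (l r) (l c)
      restrict r c rewrite labels-↑ˡ l r | labels-↑ˡ l c | weights-↑ˡ (λ _ → 0#) c | scalar-↑ˡ r c =
        +-congˡ (-‿cong (*-identityʳ _))

-- The commutative ring of polynomials, and cancellation of a monic linear factor

module PolynomialProperties {c ℓ} (R : CommutativeRing c ℓ) where
  open CommutativeRing R hiding (zero; rawRing)
  open Algebra.Properties.Ring ring using (-0#≈0#)
  open Algebra.Properties.Group +-group using (∙-cancelˡ)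
  open Relation.Binary.Reasoning.Setoid setoid
  open Spectrum (CommutativeRing.rawRing R)
  open IntegerSolver R

  private
    Seq : Set c
    Seq = ℕ → Carrier

  infixl 7 _⋆_
  -- The Cauchy product. The ring laws are proved for coefficient sequences, where list lengths and
  -- trailing zeros do not matter, and carried back along `coeff`.
  _⋆_ : Seq → Seq → Seq
  (f ⋆ g) zero    = f 0 * g 0
  (f ⋆ g) (suc k) = f 0 * g (suc k) + (f ∘ suc ⋆ g) k

  ⋆-cong : ∀ {f f′ g g′ : Seq} → (∀ k → f k ≈ f′ k) → (∀ k → g k ≈ g′ k) → ∀ k → (f ⋆ g) k ≈ (f′ ⋆ g′) k
  ⋆-cong f≈ g≈ zero    = *-cong (f≈ 0) (g≈ 0)
  ⋆-cong f≈ g≈ (suc k) = +-cong (*-cong (f≈ 0) (g≈ (suc k))) (⋆-cong (f≈ ∘ suc) g≈ k)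

  ⋆-zeroˡ : ∀ {f : Seq} g → (∀ k → f k ≈ 0#) → ∀ k → (f ⋆ g) k ≈ 0#
  ⋆-zeroˡ g f≈0 zero    = trans (*-congʳ (f≈0 0)) (zeroˡ _)
  ⋆-zeroˡ g f≈0 (suc k) = trans
    (+-cong (trans (*-congʳ (f≈0 0)) (zeroˡ _)) (⋆-zeroˡ g (f≈0 ∘ suc) k)) (+-identityʳ 0#)

  ⋆-identityˡ : ∀ {f : Seq} g → f 0 ≈ 1# → (∀ k → f (suc k) ≈ 0#) → ∀ k → (f ⋆ g) k ≈ g k
  ⋆-identityˡ g f₀≈1 f≈0 zero    = trans (*-congʳ f₀≈1) (*-identityˡ _)
  ⋆-identityˡ g f₀≈1 f≈0 (suc k) = trans
    (+-cong (trans (*-congʳ f₀≈1) (*-identityˡ _)) (⋆-zeroˡ g f≈0 k)) (+-identityʳ _)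

  ⋆-distribʳ : ∀ (h f g : Seq) k → ((λ i → f i + g i) ⋆ h) k ≈ (f ⋆ h) k + (g ⋆ h) k
  ⋆-distribʳ h f g zero    = distribʳ _ _ _
  ⋆-distribʳ h f g (suc k) = trans (+-congˡ (⋆-distribʳ h (f ∘ suc) (g ∘ suc) k))
    (solve 5 (λ a b c s t → (a :+ b) :* c :+ (s :+ t) := (a :* c :+ s) :+ (b :* c :+ t)) refl
      (f 0) (g 0) (h (suc k)) _ _)

  ⋆-scaleˡ : ∀ a (f g : Seq) k → ((λ i → a * f i) ⋆ g) k ≈ a * (f ⋆ g) k
  ⋆-scaleˡ a f g zero    = *-assoc _ _ _
  ⋆-scaleˡ a f g (suc k) = trans (+-cong (*-assoc _ _ _) (⋆-scaleˡ a (f ∘ suc) g k)) (sym (distribˡ _ _ _))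

  -- The definition peels off the head of the left factor; commutativity needs the mirror image,
  -- which peels off the head of the right factor.
  ⋆-suc : ∀ (f g : Seq) k → (f ⋆ g) (suc k) ≈ (f ⋆ g ∘ suc) k + f (suc k) * g 0
  ⋆-suc f g zero    = refl
  ⋆-suc f g (suc k) = trans (+-congˡ (⋆-suc (f ∘ suc) g k)) (sym (+-assoc _ _ _))

  ⋆-comm : ∀ (f g : Seq) k → (f ⋆ g) k ≈ (g ⋆ f) k
  ⋆-comm f g zero    = *-comm _ _
  ⋆-comm f g (suc k) = begin
    f 0 * g (suc k) + (f ∘ suc ⋆ g) k   ≈⟨ +-cong (*-comm _ _) (⋆-comm (f ∘ suc) g k) ⟩
    g (suc k) * f 0 + (g ⋆ f ∘ suc) k   ≈⟨ +-comm _ _ ⟩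
    (g ⋆ f ∘ suc) k + g (suc k) * f 0   ≈⟨ ⋆-suc g f k ⟨
    (g ⋆ f) (suc k)                     ∎

  ⋆-assoc : ∀ (f g h : Seq) k → ((f ⋆ g) ⋆ h) k ≈ (f ⋆ (g ⋆ h)) k
  ⋆-assoc f g h zero    = *-assoc _ _ _
  ⋆-assoc f g h (suc k) = begin
    f 0 * g 0 * h (suc k) + ((λ i → f 0 * g (suc i) + (f ∘ suc ⋆ g) i) ⋆ h) k
      ≈⟨ +-congˡ (⋆-distribʳ h (λ i → f 0 * g (suc i)) (f ∘ suc ⋆ g) k) ⟩
    f 0 * g 0 * h (suc k) + (((λ i → f 0 * g (suc i)) ⋆ h) k + ((f ∘ suc ⋆ g) ⋆ h) k)
      ≈⟨ +-congˡ (+-cong (⋆-scaleˡ (f 0) (g ∘ suc) h k) (⋆-assoc (f ∘ suc) g h k)) ⟩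
    f 0 * g 0 * h (suc k) + (f 0 * (g ∘ suc ⋆ h) k + (f ∘ suc ⋆ (g ⋆ h)) k)
      ≈⟨ solve 5 (λ a b c s t → a :* b :* c :+ (a :* s :+ t) := a :* (b :* c :+ s) :+ t) refl
           (f 0) (g 0) (h (suc k)) _ _ ⟩
    f 0 * (g ⋆ h) (suc k) + (f ∘ suc ⋆ (g ⋆ h)) k ∎

  coeff-+ₚ : ∀ p q k → coeff (p +ₚ q) k ≈ coeff p k + coeff q k
  coeff-+ₚ []      q       k       = sym (+-identityˡ _)
  coeff-+ₚ (a ∷ p) []      k       = sym (+-identityʳ _)
  coeff-+ₚ (a ∷ p) (b ∷ q) zero    = refl
  coeff-+ₚ (a ∷ p) (b ∷ q) (suc k) = coeff-+ₚ p q k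

  coeff-scale : ∀ a p k → coeff (map (a *_) p) k ≈ a * coeff p k
  coeff-scale a []      k       = sym (zeroʳ a)
  coeff-scale a (b ∷ p) zero    = refl
  coeff-scale a (b ∷ p) (suc k) = coeff-scale a p k

  coeff--ₚ : ∀ p k → coeff (-ₚ p) k ≈ - coeff p k
  coeff--ₚ []      k       = sym -0#≈0#
  coeff--ₚ (a ∷ p) zero    = refl
  coeff--ₚ (a ∷ p) (suc k) = coeff--ₚ p k

  coeff-*ₚ : ∀ p q k → coeff (p *ₚ q) k ≈ (coeff p ⋆ coeff q) k
  coeff-*ₚ []      q k       = sym (⋆-zeroˡ (coeff q) (λ _ → refl) k)
  coeff-*ₚ (a ∷ p) q zero    = trans (coeff-+ₚ (map (a *_) q) (0# ∷ p *ₚ q) 0)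
    (trans (+-identityʳ _) (coeff-scale a q 0))
  coeff-*ₚ (a ∷ p) q (suc k) = trans (coeff-+ₚ (map (a *_) q) (0# ∷ p *ₚ q) (suc k))
    (+-cong (coeff-scale a q (suc k)) (coeff-*ₚ p q k))

  *ₚ-comm : ∀ p q → p *ₚ q ≈ₚ q *ₚ p
  *ₚ-comm p q k = trans (coeff-*ₚ p q k) (trans (⋆-comm (coeff p) (coeff q) k) (sym (coeff-*ₚ q p k)))

  *ₚ-identityˡ : ∀ p → constant 1# *ₚ p ≈ₚ p
  *ₚ-identityˡ p k = trans (coeff-*ₚ (constant 1#) p k) (⋆-identityˡ (coeff p) refl (λ _ → refl) k)

  *ₚ-distribʳ : ∀ r p q → (p +ₚ q) *ₚ r ≈ₚ p *ₚ r +ₚ q *ₚ r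
  *ₚ-distribʳ r p q k = begin
    coeff ((p +ₚ q) *ₚ r) k                                ≈⟨ coeff-*ₚ (p +ₚ q) r k ⟩
    (coeff (p +ₚ q) ⋆ coeff r) k                           ≈⟨ ⋆-cong (coeff-+ₚ p q) (λ _ → refl) k ⟩
    ((λ i → coeff p i + coeff q i) ⋆ coeff r) k            ≈⟨ ⋆-distribʳ (coeff r) (coeff p) (coeff q) k ⟩
    (coeff p ⋆ coeff r) k + (coeff q ⋆ coeff r) k          ≈⟨ +-cong (coeff-*ₚ p r k) (coeff-*ₚ q r k) ⟨
    coeff (p *ₚ r) k + coeff (q *ₚ r) k                    ≈⟨ coeff-+ₚ (p *ₚ r) (q *ₚ r) k ⟨
    coeff (p *ₚ r +ₚ q *ₚ r) k                             ∎

  *ₚ-assoc : ∀ p q r → (p *ₚ q) *ₚ r ≈ₚ p *ₚ (q *ₚ r)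
  *ₚ-assoc p q r k = begin
    coeff ((p *ₚ q) *ₚ r) k                    ≈⟨ coeff-*ₚ (p *ₚ q) r k ⟩
    (coeff (p *ₚ q) ⋆ coeff r) k               ≈⟨ ⋆-cong (coeff-*ₚ p q) (λ _ → refl) k ⟩
    ((coeff p ⋆ coeff q) ⋆ coeff r) k          ≈⟨ ⋆-assoc (coeff p) (coeff q) (coeff r) k ⟩
    (coeff p ⋆ (coeff q ⋆ coeff r)) k          ≈⟨ ⋆-cong (λ _ → refl) (coeff-*ₚ q r) k ⟨
    (coeff p ⋆ coeff (q *ₚ r)) k               ≈⟨ coeff-*ₚ p (q *ₚ r) k ⟨
    coeff (p *ₚ (q *ₚ r)) k                    ∎

  polyCommutativeRing : CommutativeRing c ℓ
  polyCommutativeRing = record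
    { Carrier = Poly ; _≈_ = _≈ₚ_ ; _+_ = _+ₚ_ ; _*_ = _*ₚ_ ; -_ = -ₚ_ ; 0# = [] ; 1# = constant 1#
    ; isCommutativeRing = record
      { isRing = record
        { +-isAbelianGroup = record
          { isGroup = record
            { isMonoid = record
              { isSemigroup = record
                { isMagma = record
                  { isEquivalence = record
                    { refl  = λ _ → refl
                    ; sym   = λ p≈q k → sym (p≈q k)
                    ; trans = λ p≈q q≈r k → trans (p≈q k) (q≈r k) }
                  ; ∙-cong = λ {p} {p′} {q} {q′} p≈p′ q≈q′ k →
                      trans (coeff-+ₚ p q k) (trans (+-cong (p≈p′ k) (q≈q′ k)) (sym (coeff-+ₚ p′ q′ k))) }
                ; assoc = λ p q r k → begin
                    coeff ((p +ₚ q) +ₚ r) k               ≈⟨ coeff-+ₚ (p +ₚ q) r k ⟩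
                    coeff (p +ₚ q) k + coeff r k          ≈⟨ +-congʳ (coeff-+ₚ p q k) ⟩
                    coeff p k + coeff q k + coeff r k     ≈⟨ +-assoc _ _ _ ⟩
                    coeff p k + (coeff q k + coeff r k)   ≈⟨ +-congˡ (coeff-+ₚ q r k) ⟨
                    coeff p k + coeff (q +ₚ r) k          ≈⟨ coeff-+ₚ p (q +ₚ r) k ⟨
                    coeff (p +ₚ (q +ₚ r)) k               ∎ }
              ; identity = (λ _ _ → refl) , (λ p k → trans (coeff-+ₚ p [] k) (+-identityʳ _)) }
            ; inverse = (λ p k → trans (coeff-+ₚ (-ₚ p) p k) (trans (+-congʳ (coeff--ₚ p k)) (-‿inverseˡ _)))
                      , (λ p k → trans (coeff-+ₚ p (-ₚ p) k) (trans (+-congˡ (coeff--ₚ p k)) (-‿inverseʳ _)))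
            ; ⁻¹-cong = λ {p} {q} p≈q k → trans (coeff--ₚ p k) (trans (-‿cong (p≈q k)) (sym (coeff--ₚ q k))) }
          ; comm = λ p q k → trans (coeff-+ₚ p q k) (trans (+-comm _ _) (sym (coeff-+ₚ q p k))) }
        ; *-cong = λ {p} {p′} {q} {q′} p≈p′ q≈q′ k →
            trans (coeff-*ₚ p q k) (trans (⋆-cong p≈p′ q≈q′ k) (sym (coeff-*ₚ p′ q′ k)))
        ; *-assoc = *ₚ-assoc
        ; *-identity = *ₚ-identityˡ , (λ p k → trans (*ₚ-comm p (constant 1#) k) (*ₚ-identityˡ p k))
        ; distrib = (λ r p q k → begin
              coeff (r *ₚ (p +ₚ q)) k                ≈⟨ *ₚ-comm r (p +ₚ q) k ⟩
              coeff ((p +ₚ q) *ₚ r) k                ≈⟨ *ₚ-distribʳ r p q k ⟩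
              coeff (p *ₚ r +ₚ q *ₚ r) k             ≈⟨ coeff-+ₚ (p *ₚ r) (q *ₚ r) k ⟩
              coeff (p *ₚ r) k + coeff (q *ₚ r) k    ≈⟨ +-cong (*ₚ-comm p r k) (*ₚ-comm q r k) ⟩
              coeff (r *ₚ p) k + coeff (r *ₚ q) k    ≈⟨ coeff-+ₚ (r *ₚ p) (r *ₚ q) k ⟨
              coeff (r *ₚ p +ₚ r *ₚ q) k             ∎)
          , *ₚ-distribʳ }
      ; *-comm = *ₚ-comm } }

  coeff-length : ∀ p k → length p ℕ.≤ k → coeff p k ≈ 0#
  coeff-length []      k       _         = refl
  coeff-length (a ∷ p) (suc k) (s≤s p≤k) = coeff-length p k p≤k

  coeff-X+a* : ∀ a p k → coeff ((X +ₚ constant a) *ₚ p) (suc k) ≈ (0# + a) * coeff p (suc k) + coeff p k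
  coeff-X+a* a p k = trans (coeff-*ₚ (X +ₚ constant a) p (suc k))
    (+-congˡ (⋆-identityˡ (coeff p) refl (λ _ → refl) k))

  -- Coefficients are compared from the top down, starting where both are 0.
  X+a-cancel : ∀ a p q → (X +ₚ constant a) *ₚ p ≈ₚ (X +ₚ constant a) *ₚ q → p ≈ₚ q
  X+a-cancel a p q yp≈yq k = descend (length p ℕ.+ length q) k (ℕ.m≤m+n _ k)
    where
    descend : ∀ t k → length p ℕ.+ length q ℕ.≤ t ℕ.+ k → coeff p k ≈ coeff q k
    descend zero    k b = trans (coeff-length p k (ℕ.m+n≤o⇒m≤o _ b)) (sym (coeff-length q k (ℕ.m+n≤o⇒n≤o (length p) b)))
    descend (suc t) k b = ∙-cancelˡ ((0# + a) * coeff p (suc k)) _ _ (begin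
      (0# + a) * coeff p (suc k) + coeff p k          ≈⟨ coeff-X+a* a p k ⟨
      coeff ((X +ₚ constant a) *ₚ p) (suc k)          ≈⟨ yp≈yq (suc k) ⟩
      coeff ((X +ₚ constant a) *ₚ q) (suc k)          ≈⟨ coeff-X+a* a q k ⟩
      (0# + a) * coeff q (suc k) + coeff q k          ≈⟨ +-congʳ (*-congˡ (descend t (suc k) (ℕ.≤-trans b (ℕ.≤-reflexive (≡.sym (ℕ.+-suc t k)))))) ⟨
      (0# + a) * coeff p (suc k) + coeff q k          ∎)

  constant-cong : ∀ {a b} → a ≈ b → constant a ≈ₚ constant b
  constant-cong a≈b zero    = a≈b
  constant-cong a≈b (suc k) = refl

  constant-0# : constant 0# ≈ₚ []
  constant-0# zero    = refl
  constant-0# (suc k) = refl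

  constant-* : ∀ a b → constant (a * b) ≈ₚ constant a *ₚ constant b
  constant-* a b zero    = sym (+-identityʳ _)
  constant-* a b (suc k) = sym (constant-0# (suc k))

  -- Turns a coefficient list such as `g` into an expression in ring operations, which can be
  -- compared with a computed determinant.
  ∷-horner : ∀ a p → a ∷ p ≈ₚ constant a +ₚ X *ₚ p
  ∷-horner a p k = sym (trans (coeff-+ₚ (constant a) (X *ₚ p) k) (trans (+-congˡ (coeff-*ₚ X p k)) (lemma k)))
    where
    lemma : ∀ k → coeff (constant a) k + (coeff X ⋆ coeff p) k ≈ coeff (a ∷ p) k
    lemma zero    = trans (+-congˡ (zeroˡ _)) (+-identityʳ a)
    lemma (suc k) = trans (+-identityˡ _)
      (trans (+-cong (zeroˡ _) (⋆-identityˡ (coeff p) refl (λ _ → refl) k)) (+-identityˡ _))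

-- Distances, parents and edges in a tree

module TreeProperties {n} (T : Tree n) where
  open ≡ using (refl; sym; trans)
  open import Data.Nat.Base using (_+_; _⊓_)
  open Tree T

  geodesic : ∀ i j → Walk (d i j) i j
  geodesic i j = proj₁ (proj₂ (distance i j))

  d-minimal : ∀ {i j k} → Walk k i j → d i j ≤ k
  d-minimal {i} {j} = proj₂ (proj₂ (distance i j))

  _++ʷ_ : ∀ {k m x y z} → Walk k x y → Walk m y z → Walk (k + m) x z
  []      ++ʷ w = w
  (e ∷ v) ++ʷ w = e ∷ (v ++ʷ w)

  reverse : ∀ {k x y} → Walk k x y → Walk k y x
  reverse []      = []
  reverse {suc k} {x} {y} (e ∷ w) = subst (λ m → Walk m y x) (ℕ.+-comm k 1) (reverse w ++ʷ (symm e ∷ []))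

  d-refl : ∀ x → d x x ≡ 0
  d-refl x = ℕ.n≤0⇒n≡0 (d-minimal [])

  d-sym : ∀ x y → d x y ≡ d y x
  d-sym x y = ℕ.≤-antisym (d-minimal (reverse (geodesic y x))) (d-minimal (reverse (geodesic x y)))

  d-triangle : ∀ x y z → d x z ≤ d x y + d y z
  d-triangle x y z = d-minimal (geodesic x y ++ʷ geodesic y z)

  d≡0⇒≡ : ∀ {x y} → d x y ≡ 0 → x ≡ y
  d≡0⇒≡ {x} {y} d≡0 with [] ← subst (λ m → Walk m x y) d≡0 (geodesic x y) = refl

  d≡1⇒Adj : ∀ {x y} → d x y ≡ 1 → Adj x y
  d≡1⇒Adj {x} {y} d≡1 with e ∷ [] ← subst (λ m → Walk m x y) d≡1 (geodesic x y) = e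

  Adj⇒≢ : ∀ {x y} → Adj x y → x ≢ y
  Adj⇒≢ e refl = irrefl e

  Adj⇒d≡1 : ∀ {x y} → Adj x y → d x y ≡ 1
  Adj⇒d≡1 {x} {y} e = ℕ.≤-antisym (d-minimal (e ∷ [])) (ℕ.n≢0⇒n>0 (Adj⇒≢ e ∘ d≡0⇒≡))

  private
    next : ∀ {m x y} → Walk m x y → Fin n
    next {x = x} []              = x
    next         (_∷_ {j = y} _ _) = y

    next-geodesic : ∀ {m x y} (w : Walk m x y) → (∀ {k} → Walk k x y → m ≤ k) → x ≢ y →
                    Adj x (next w) × m ≡ suc (d (next w) y)
    next-geodesic []      _   x≢x = contradiction refl x≢x
    next-geodesic (e ∷ w) min _   = e , ℕ.≤-antisym (min (e ∷ geodesic _ _)) (s≤s (d-minimal w))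

    next-closed : ∀ {m x} (w : Walk m x x) → m ≡ 0 → next w ≡ x
    next-closed [] _ = refl

  -- The second vertex of the geodesic from v to r that `distance` provides. At the root the
  -- geodesic is empty and the default is the root itself.
  parent : Fin n → Fin n → Fin n
  parent r v = next (geodesic v r)

  parent-Adj : ∀ {r v} → v ≢ r → Adj v (parent r v)
  parent-Adj {r} {v} v≢r = proj₁ (next-geodesic (geodesic v r) d-minimal v≢r)

  d-parent : ∀ {r v} → v ≢ r → d v r ≡ suc (d (parent r v) r)
  d-parent {r} {v} v≢r = proj₂ (next-geodesic (geodesic v r) d-minimal v≢r)

  parent-root : ∀ r → parent r r ≡ r
  parent-root r = next-closed (geodesic r r) (d-refl r)

  parent-Adj⇒≢ : ∀ {r v u} → Adj v u → parent r v ≡ u → v ≢ r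
  parent-Adj⇒≢ e refl refl = Adj⇒≢ e (sym (parent-root _))

  d≡suc⇒≢ : ∀ {x y k} → d x y ≡ suc k → x ≢ y
  d≡suc⇒≢ d≡ refl with () ← trans (sym d≡) (d-refl _)

  -- Two parent steps lower the distance to the root by 2 and so cannot return to v, unless u is the
  -- root, where the second step stalls and would force v to be the root as well.
  parent-asym : ∀ {r u v} → v ≢ r → parent r v ≡ u → parent r u ≢ v
  parent-asym {r} {u} {v} v≢r pv≡u pu≡v with u ≟ r
  ... | yes u≡r = v≢r (trans (sym pu≡v) (trans (cong (parent r) u≡r) (parent-root r)))
  ... | no u≢r  = ℕ.m≢1+m+n (d v r) {1} (begin
      d v r                             ≡⟨ d-parent v≢r ⟩
      suc (d (parent r v) r)            ≡⟨ cong (λ x → suc (d x r)) pv≡u ⟩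
      suc (d u r)                       ≡⟨ cong suc (d-parent u≢r) ⟩
      suc (suc (d (parent r u) r))      ≡⟨ cong (λ x → suc (suc (d x r))) pu≡v ⟩
      suc (suc (d v r))                 ≡⟨ cong suc (ℕ.+-comm 1 (d v r)) ⟩
      suc (d v r + 1)                   ∎)
      where open ≡-Reasoning

  private
    prefix : ∀ {m x z u} (w : Walk m x z) → Unique (vertices w) → u ∈ᴸ vertices w →
             ∃[ k ] ∃ λ (v : Walk k x u) → Unique (vertices v) × (∀ {t} → t ∈ᴸ vertices v → t ∈ᴸ vertices w)
    prefix []      _        (here refl) = 0 , [] , [] ∷ [] , id
    prefix (e ∷ w) _        (here refl) = 0 , [] , [] ∷ [] , λ { (here eq) → here eq }
    prefix (e ∷ w) (x∉ ∷ w!) (there u∈) =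
      let k , v , v! , v⊆w = prefix w w! u∈ in
      suc k , e ∷ v , All.tabulate (λ t∈ → All.lookup x∉ (v⊆w t∈)) ∷ v! ,
      λ { (here eq) → here eq ; (there t∈) → there (v⊆w t∈) }

    -- A repeated vertex would close up a cycle.
    extend : ∀ {m x y z u} (a : Adj u x) (e : Adj x y) (w : Walk m y z) → u ≢ y →
             Unique (vertices (e ∷ w)) → Unique (vertices (a ∷ e ∷ w))
    extend {x = x} {y} {u = u} a e w u≢y ew!@(x∉ ∷ w!) = ¬Any⇒All¬ _ u∉ ∷ ew!
      where
      u∉ : ¬ u ∈ᴸ vertices (e ∷ w)
      u∉ (here refl) = irrefl a
      u∉ (there u∈) with prefix w w! u∈
      ... | zero  , []    , _  , _   = u≢y refl
      ... | suc k , v     , v! , v⊆w =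
        acyclic (e ∷ v) (s≤s (s≤s z≤n)) (All.tabulate (λ t∈ → All.lookup x∉ (v⊆w t∈)) ∷ v!) a

    end∈ : ∀ {m x z} (w : Walk m x z) → z ∈ᴸ vertices w
    end∈ []      = here refl
    end∈ (e ∷ w) = there (end∈ w)

    -- Consecutive parent steps never turn back, so `extend` keeps the vertices distinct all the way
    -- to the root. The first edge is kept apart because `extend` and `climb` inspect it.
    ascent : ∀ r m v → d v r ≡ suc m →
             ∃[ k ] ∃ λ (e : Adj v (parent r v)) → ∃ λ (w : Walk k (parent r v) r) → Unique (vertices (e ∷ w))
    ascent r zero v dv≡ = 0 , e , w , unique e w v≢r
      where
      v≢r = d≡suc⇒≢ dv≡
      e = parent-Adj v≢r
      w : Walk 0 (parent r v) r
      w = subst (λ m → Walk m (parent r v) r) (ℕ.suc-injective (trans (sym (d-parent v≢r)) dv≡)) (geodesic (parent r v) r)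
      unique : ∀ {x} (e : Adj v x) (w : Walk 0 x r) → v ≢ r → Unique (vertices (e ∷ w))
      unique e [] v≢r = (v≢r ∷ []) ∷ [] ∷ []
    ascent r (suc m) v dv≡ =
      let v≢r = d≡suc⇒≢ dv≡
          k , e , w , ew! = ascent r m (parent r v) (ℕ.suc-injective (trans (sym (d-parent v≢r)) dv≡))
      in suc k , parent-Adj v≢r , e ∷ w , extend (parent-Adj v≢r) e w (parent-asym v≢r refl ∘ sym) ew!

    -- Prepending the ancestors of x until the root is reached turns the walk into a closed path.
    climb : ∀ r m {k x y} → d x r ≡ m → (e : Adj x y) (w : Walk k y r) → Unique (vertices (e ∷ w)) →
            ¬ (parent r x ≢ y)
    climb r zero    dx≡0 e w (x∉ ∷ _) _ with refl ← d≡0⇒≡ dx≡0 = All.lookup x∉ (end∈ w) refl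
    climb r (suc m) dx≡  e w ew! px≢y =
      climb r m (ℕ.suc-injective (trans (sym (d-parent x≢r)) dx≡)) a (e ∷ w)
        (extend a e w px≢y ew!) (parent-asym x≢r refl)
      where
      x≢r = d≡suc⇒≢ dx≡
      a = symm (parent-Adj x≢r)

  -- Otherwise the edge from k to l continues with the ascent of l as a path ending at r. Climbing
  -- from k prolongs this path backwards until it meets r a second time.
  Adj⇒parent : ∀ r {k l} → Adj k l → parent r k ≡ l ⊎ parent r l ≡ k
  Adj⇒parent r {k} {l} a with parent r k ≟ l | parent r l ≟ k
  ... | yes pk≡l | _        = inj₁ pk≡l
  ... | no _     | yes pl≡k = inj₂ pl≡k
  ... | no pk≢l  | no pl≢k  = contradiction pk≢l (absurd (d l r) refl)
    where
    absurd : ∀ m → d l r ≡ m → ¬ (parent r k ≢ l)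
    absurd zero    dl≡0 with refl ← d≡0⇒≡ dl≡0 = climb r (d k r) refl a [] ((Adj⇒≢ a ∷ []) ∷ [] ∷ [])
    absurd (suc m) dl≡  = let _ , e , w , ew! = ascent r m l dl≡ in
      climb r (d k r) refl a (e ∷ w) (extend a e w (pl≢k ∘ sym) ew!)

  Adj-root⇒parent : ∀ {r v} → Adj r v → parent r v ≡ r
  Adj-root⇒parent rv = d≡0⇒≡ (ℕ.suc-injective (trans (sym (d-parent (Adj⇒≢ (symm rv)))) (Adj⇒d≡1 (symm rv))))

  -- Rooted at a, both b and c have parent a, while the edge between them would make one the parent
  -- of the other.
  no-triangle : ∀ {a b c} → Adj a b → Adj a c → ¬ Adj b c
  no-triangle {a} {b} {c} ab ac bc with Adj⇒parent a bc
  ... | inj₁ pb≡c = Adj⇒≢ ac (trans (sym (Adj-root⇒parent ab)) pb≡c)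
  ... | inj₂ pc≡b = Adj⇒≢ ab (trans (sym (Adj-root⇒parent ac)) pc≡b)

  -- If the sum is below 2, either the edges coincide or they share an end while their other ends
  -- are adjacent, which is a triangle.
  distinct-edges : ∀ {a b c e} → Adj a b → Adj c e → ¬ (a ≡ c × b ≡ e) → 2 ≤ d a c + d b e
  distinct-edges {a} {b} {c} {e} ab ce ≢ with d a c in dac | d b e in dbe
  ... | suc x       | suc y       = s≤s (ℕ.≤-trans (s≤s z≤n) (ℕ.m≤n+m (suc y) x))
  ... | suc (suc x) | zero        = s≤s (s≤s z≤n)
  ... | zero        | suc (suc y) = s≤s (s≤s z≤n)
  ... | zero        | zero        = contradiction (d≡0⇒≡ dac , d≡0⇒≡ dbe) ≢
  ... | suc zero    | zero with refl ← d≡0⇒≡ dbe = contradiction (d≡1⇒Adj dac) (no-triangle (symm ab) (symm ce))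
  ... | zero        | suc zero with refl ← d≡0⇒≡ dac = contradiction (d≡1⇒Adj dbe) (no-triangle ab ce)

  -- The entry for ordered pairs. Its symmetries let an edge be written from child to parent,
  -- whatever its increasing listing.
  min4 : Fin n → Fin n → Fin n → Fin n → ℕ
  min4 a b c e = ((d a e + d b c) ⊓ (d a c + d b e)) ⊓ (d a b + d c e)

  min4-swapˡ : ∀ a b c e → min4 a b c e ≡ min4 b a c e
  min4-swapˡ a b c e = cong₂ _⊓_
    (trans (ℕ.⊓-comm (d a e + d b c) _) (cong₂ _⊓_ (ℕ.+-comm (d a c) _) (ℕ.+-comm (d a e) _)))
    (cong (_+ d c e) (d-sym a b))

  min4-swap : ∀ a b c e → min4 a b c e ≡ min4 c e a b
  min4-swap a b c e = cong₂ _⊓_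
    (cong₂ _⊓_ (trans (ℕ.+-comm (d a e) _) (cong₂ _+_ (d-sym b c) (d-sym a e)))
               (cong₂ _+_ (d-sym a c) (d-sym b e)))
    (ℕ.+-comm (d a b) _)

  Ends : 𝒱₂ n → Fin n → Fin n → Set
  Ends (pair a b _) u v = (a ≡ u × b ≡ v) ⊎ (a ≡ v × b ≡ u)

  Ends-unique : ∀ p p′ {u v} → Ends p u v → Ends p′ u v → p ≡ p′
  Ends-unique _ _ (inj₁ (refl , refl)) (inj₁ (refl , refl)) = refl
  Ends-unique _ _ (inj₂ (refl , refl)) (inj₂ (refl , refl)) = refl
  Ends-unique (pair u v u<v) (pair _ _ v<u) (inj₁ (refl , refl)) (inj₂ (refl , refl)) =
    ⊥-elim-irr (ℕ.<-asym u<v v<u)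
  Ends-unique (pair u v u<v) (pair _ _ v<u) (inj₂ (refl , refl)) (inj₁ (refl , refl)) =
    ⊥-elim-irr (ℕ.<-asym u<v v<u)

  pairOf : ∀ {u v} → u ≢ v → ∃ λ p → Ends p u v
  pairOf {u} {v} u≢v with Fin.<-cmp u v
  ... | tri< u<v _ _ = pair u v u<v , inj₁ (refl , refl)
  ... | tri≈ _ u≡v _ = contradiction u≡v u≢v
  ... | tri> _ _ v<u = pair v u v<u , inj₂ (refl , refl)

  Ends⇒E : ∀ p {u v} → Ends p u v → Adj u v → p ∈ E T
  Ends⇒E _ (inj₁ (refl , refl)) e = e
  Ends⇒E _ (inj₂ (refl , refl)) e = symm e

  Min4PC-Ends : ∀ p p′ {a b c e} → Ends p a b → Ends p′ c e → Min4PC T p p′ ≡ min4 a b c e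
  Min4PC-Ends _ _ (inj₁ (refl , refl)) (inj₁ (refl , refl)) = refl
  Min4PC-Ends _ _ {a} {b} {c} {e} (inj₂ (refl , refl)) (inj₁ (refl , refl)) = min4-swapˡ b a c e
  Min4PC-Ends _ _ {a} {b} {c} {e} (inj₁ (refl , refl)) (inj₂ (refl , refl)) =
    trans (min4-swap a b e c) (trans (min4-swapˡ e c a b) (min4-swap c e a b))
  Min4PC-Ends _ _ {a} {b} {c} {e} (inj₂ (refl , refl)) (inj₂ (refl , refl)) =
    trans (min4-swapˡ b a e c) (trans (min4-swap a b e c) (trans (min4-swapˡ e c a b) (min4-swap c e a b)))

  Min4PC-diagonal : ∀ p → Min4PC T p p ≡ 0
  Min4PC-diagonal (pair a b _) rewrite d-refl a | d-refl b = cong (_⊓ (d a b + d a b)) (ℕ.⊓-zeroʳ (d a b + d b a))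

  -- The pairing within the edges gives 1 + 1, and each crossed pairing is at least 2 by
  -- `distinct-edges`.
  min4-distinct-edges : ∀ {a b c e} → Adj a b → Adj c e → ¬ (a ≡ c × b ≡ e) → ¬ (a ≡ e × b ≡ c) → min4 a b c e ≡ 2
  min4-distinct-edges {a} {b} {c} {e} ab ce ≢₁ ≢₂ = begin
    min4 a b c e
      ≡⟨ cong ((d a e + d b c) ⊓ (d a c + d b e) ⊓_) (cong₂ _+_ (Adj⇒d≡1 ab) (Adj⇒d≡1 ce)) ⟩
    (d a e + d b c) ⊓ (d a c + d b e) ⊓ 2
      ≡⟨ ℕ.m≥n⇒m⊓n≡n (ℕ.⊓-glb (distinct-edges ab (symm ce) ≢₂) (distinct-edges ab ce ≢₁)) ⟩
    2 ∎
    where open ≡-Reasoning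

-- The entries in terms of the path between i and j

module Entries (d′ : ℕ) where
  open ≡ using (refl)

  -- With d written as `suc d′`, these are d - 1 on the path and d + 1 off it, without truncated
  -- subtraction.
  f-entry : Fin 2 → ℕ
  f-entry zero    = d′
  f-entry (suc _) = suc (suc d′)

  -- The label 0 stands for f, 1 for the edges on the path from i to j, and 2 for the other edges.
  entry : Fin 3 → Fin 3 → ℕ
  entry zero    zero    = 2
  entry zero    (suc t) = f-entry t
  entry (suc s) (suc t) = 2
  entry (suc s) zero    = f-entry s

  -- This is what makes a single shift by 2 suffice. Label 0 belongs to `f` alone, so its diagonal
  -- value comes from the shift only; for the other labels it is also the entry of two distinct
  -- edges.
  entry-diagonal : ∀ t → entry t t ≡ 2
  entry-diagonal zero    = refl
  entry-diagonal (suc t) = refl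

  entry-sym-f : ∀ t → entry zero t ≡ entry t zero
  entry-sym-f zero    = refl
  entry-sym-f (suc t) = refl

module Path {n} (T : Tree n) (i j : Fin n) .(i<j : i Fin.< j)
            {d′} (dij≡ : Tree.d T i j ≡ suc d′) (1<d : 1 < suc d′) where
  open ≡ using (refl; sym; trans)
  open import Data.Nat.Base using (_+_; _⊓_)
  open Tree T
  open TreeProperties T
  open Entries d′

  f : 𝒱₂ n
  f = pair i j i<j

  -- The path from j up to the root i, reached at t = d.
  q : ℕ → Fin n
  q zero    = j
  q (suc t) = parent i (q t)

  depth⇒≢ : ∀ {t v} → t < suc d′ → t + d v i ≡ suc d′ → v ≢ i
  depth⇒≢ {t} t<D t+dv≡D refl = ℕ.<⇒≢ t<D (trans (sym (ℕ.+-identityʳ t)) (trans (cong (t ℕ.+_) (sym (d-refl i))) t+dv≡D))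

  q-depth : ∀ t → t ≤ suc d′ → t + d (q t) i ≡ suc d′
  q-depth zero    _   = trans (d-sym j i) dij≡
  q-depth (suc t) t<D = begin
    suc t + d (q (suc t)) i     ≡⟨ ℕ.+-suc t _ ⟨
    t + suc (d (q (suc t)) i)   ≡⟨ cong (t ℕ.+_) (d-parent (depth⇒≢ t<D (q-depth t (ℕ.<⇒≤ t<D)))) ⟨
    t + d (q t) i               ≡⟨ q-depth t (ℕ.<⇒≤ t<D) ⟩
    suc d′                      ∎
    where open ≡-Reasoning

  q≢i : ∀ {t} → t < suc d′ → q t ≢ i
  q≢i {t} t<D = depth⇒≢ t<D (q-depth t (ℕ.<⇒≤ t<D))

  q-injective : ∀ {s t} → s ≤ suc d′ → t ≤ suc d′ → q s ≡ q t → s ≡ t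
  q-injective {s} {t} s≤D t≤D qs≡qt = ℕ.+-cancelʳ-≡ (d (q s) i) s t
    (trans (q-depth s s≤D) (trans (sym (q-depth t t≤D)) (cong (λ x → t + d x i) (sym qs≡qt))))

  -- The t steps from j bound the distance above. It cannot be smaller, since the remaining d - t
  -- steps to i would then give a walk from j to i shorter than d.
  q-codepth : ∀ t → t ≤ suc d′ → d j (q t) ≡ t
  q-codepth t t≤D = ℕ.≤-antisym (upper t t≤D) (ℕ.+-cancelʳ-≤ (d (q t) i) t (d j (q t)) (begin
    t + d (q t) i             ≡⟨ q-depth t t≤D ⟩
    suc d′                    ≡⟨ trans (d-sym j i) dij≡ ⟨
    d j i                     ≤⟨ d-triangle j (q t) i ⟩
    d j (q t) + d (q t) i     ∎))
    where
    open ℕ.≤-Reasoning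
    upper : ∀ t → t ≤ suc d′ → d j (q t) ≤ t
    upper zero    _   = ℕ.≤-reflexive (d-refl j)
    upper (suc t) t<D = begin
      d j (q (suc t))                 ≤⟨ d-triangle j (q t) (q (suc t)) ⟩
      d j (q t) + d (q t) (q (suc t)) ≤⟨ ℕ.+-mono-≤ (upper t (ℕ.<⇒≤ t<D)) (ℕ.≤-reflexive (Adj⇒d≡1 (parent-Adj (q≢i t<D)))) ⟩
      t + 1                           ≡⟨ ℕ.+-comm t 1 ⟩
      suc t                           ∎

  -- The lower ends of the path edges: t runs over 0, ..., d - 1, so i is left out and the witnesses
  -- number exactly d.
  OnPath : Fin n → Set
  OnPath v = ∃ λ (t : Fin (suc d′)) → q (toℕ t) ≡ v

  onPath? : ∀ v → Dec (OnPath v)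
  onPath? v = any? λ t → q (toℕ t) ≟ v

  -- The neighbour of v towards j satisfies the same hypotheses.
  opposite⇒OnPath : ∀ k v → d v j ≡ k → v ≢ i → parent j (parent i v) ≡ v → OnPath v
  opposite⇒OnPath zero    v dvj≡ v≢i _ = zero , sym (d≡0⇒≡ dvj≡)
  opposite⇒OnPath (suc k) v dvj≡ v≢i ppv≡v with Adj⇒parent i (parent-Adj v≢j)
    where v≢j = d≡suc⇒≢ dvj≡
  ... | inj₁ pv≡u = contradiction (trans (cong (parent j) (sym pv≡u)) ppv≡v) (parent-asym (d≡suc⇒≢ dvj≡) refl)
  ... | inj₂ pu≡v with opposite⇒OnPath k (parent j v) (ℕ.suc-injective (trans (sym (d-parent v≢j)) dvj≡))
                         (parent-Adj⇒≢ (symm (parent-Adj v≢j)) pu≡v) (cong (parent j) pu≡v)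
    where v≢j = d≡suc⇒≢ dvj≡
  ... | t , qt≡u = fromℕ< 1+t<D , trans (cong q (toℕ-fromℕ< 1+t<D)) q1+t≡v
    where
    q1+t≡v : q (suc (toℕ t)) ≡ v
    q1+t≡v = trans (cong (parent i) qt≡u) pu≡v
    -- At position d the path has reached i, whereas v differs from i.
    1+t<D : suc (toℕ t) < suc d′
    1+t<D = ℕ.≤∧≢⇒< (toℕ<n t) λ 1+t≡D → v≢i (trans (sym q1+t≡v)
      (d≡0⇒≡ (ℕ.+-cancelˡ-≡ (suc (toℕ t)) _ _ (trans (q-depth (suc (toℕ t)) (toℕ<n t)) (trans (sym 1+t≡D) (sym (ℕ.+-identityʳ _)))))))

  -- If v is t steps from j, then its parent p is d - t - 1 steps from i, and the crossed sum d(i,p)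
  -- + d(j,v) is d - 1. The other crossed sum replaces each summand by one larger by 1, and the
  -- remaining pairing is at least d.
  min4-onPath : ∀ {v} → OnPath v → min4 i j v (parent i v) ≡ d′
  min4-onPath (t′ , refl) = begin
    (d i p + d j v) ⊓ (d i v + d j p) ⊓ (d i j + d v p)
      ≡⟨ ℕ.m≤n⇒m⊓n≡m (ℕ.≤-trans (ℕ.m⊓n≤m _ (d i v + d j p)) (ℕ.≤-trans (ℕ.≤-reflexive first) (ℕ.≤-trans (ℕ.n≤1+n d′)
           (ℕ.≤-trans (ℕ.≤-reflexive (sym dij≡)) (ℕ.m≤m+n (d i j) (d v p)))))) ⟩
    (d i p + d j v) ⊓ (d i v + d j p)
      ≡⟨ ℕ.m≤n⇒m⊓n≡m (ℕ.+-mono-≤ (ℕ.≤-trans (ℕ.n≤1+n _) (ℕ.≤-reflexive (sym div≡)))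
           (ℕ.≤-trans (ℕ.≤-reflexive (q-codepth t (ℕ.<⇒≤ t<D))) (ℕ.≤-trans (ℕ.n≤1+n t) (ℕ.≤-reflexive (sym (q-codepth (suc t) t<D)))))) ⟩
    d i p + d j v
      ≡⟨ first ⟩
    d′ ∎
    where
    open ≡-Reasoning
    t = toℕ t′
    t<D = toℕ<n t′
    v = q t
    p = q (suc t)
    first : d i p + d j v ≡ d′
    first = trans (cong₂ _+_ (d-sym i p) (q-codepth t (ℕ.<⇒≤ t<D)))
      (trans (ℕ.+-comm (d p i) t) (ℕ.suc-injective (q-depth (suc t) t<D)))
    div≡ : d i v ≡ suc (d i p)
    div≡ = trans (d-sym i v) (trans (d-parent (q≢i t<D)) (cong suc (d-sym p i)))

  -- Off the path, the parent p is nearer than v to both i and j. Both crossed sums then equal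
  -- d(i,p) + d(j,p) + 1, which is at least d + 1 by the triangle inequality, and the remaining
  -- pairing is exactly d + 1.
  min4-offPath : ∀ {v} → v ≢ i → ¬ OnPath v → min4 i j v (parent i v) ≡ suc (suc d′)
  min4-offPath {v} v≢i off = begin
    (d i p + d j v) ⊓ (d i v + d j p) ⊓ (d i j + d v p)
      ≡⟨ cong ((d i p + d j v) ⊓ (d i v + d j p) ⊓_) (trans (cong₂ _+_ dij≡ (Adj⇒d≡1 vp)) (ℕ.+-comm (suc d′) 1)) ⟩
    (d i p + d j v) ⊓ (d i v + d j p) ⊓ suc (suc d′)
      ≡⟨ ℕ.m≥n⇒m⊓n≡n (ℕ.⊓-glb first second) ⟩
    suc (suc d′) ∎
    where
    open ≡-Reasoning
    p = parent i v
    vp = parent-Adj v≢i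
    detour : suc (suc d′) ≤ suc (d i p + d j p)
    detour = s≤s (ℕ.≤-trans (ℕ.≤-reflexive (sym dij≡)) (ℕ.≤-trans (d-triangle i p j) (ℕ.≤-reflexive (cong (d i p ℕ.+_) (d-sym p j)))))
    djv≡ : d j v ≡ suc (d j p)
    djv≡ with Adj⇒parent j vp
    ... | inj₁ pv≡p = trans (d-sym j v) (trans (d-parent (parent-Adj⇒≢ vp pv≡p)) (cong suc (trans (cong (λ x → d x j) pv≡p) (d-sym p j))))
    ... | inj₂ pp≡v = contradiction (opposite⇒OnPath _ v refl v≢i pp≡v) off
    first : suc (suc d′) ≤ d i p + d j v
    first = ℕ.≤-trans detour (ℕ.≤-reflexive (trans (sym (ℕ.+-suc _ _)) (cong (d i p ℕ.+_) (sym djv≡))))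
    second : suc (suc d′) ≤ d i v + d j p
    second = ℕ.≤-trans detour (ℕ.≤-reflexive (cong (_+ d j p) (sym (trans (d-sym i v) (trans (d-parent v≢i) (cong suc (d-sym p i)))))))

  -- The correspondence between pairs in B and vertices is kept as a relation: totality and
  -- uniqueness are proved separately in each direction, and together give a bijection.
  data Rep (p : 𝒱₂ n) (v : Fin n) : Set where
    root : v ≡ i → p ≡ f → Rep p v
    edge : v ≢ i → Ends p v (parent i v) → Rep p v

  Rep-total : ∀ p → p ∈ (E T ∪ ｛ f ｝) → ∃ (Rep p)
  Rep-total p (inj₂ f≡p) = i , root refl (sym f≡p)
  Rep-total (pair a b _) (inj₁ ab) with Adj⇒parent i ab
  ... | inj₁ pa≡b = a , edge (parent-Adj⇒≢ ab pa≡b) (inj₁ (refl , sym pa≡b))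
  ... | inj₂ pb≡a = b , edge (parent-Adj⇒≢ (symm ab) pb≡a) (inj₂ (sym pb≡a , refl))

  Rep-surjective : ∀ v → ∃ λ p → p ∈ (E T ∪ ｛ f ｝) × Rep p v
  Rep-surjective v with v ≟ i
  ... | yes v≡i = f , inj₂ refl , root v≡i refl
  ... | no v≢i  = let p , ends = pairOf (Adj⇒≢ (parent-Adj v≢i)) in
                  p , inj₁ (Ends⇒E p ends (parent-Adj v≢i)) , edge v≢i ends

  Rep-functional : ∀ {p p′ v} → Rep p v → Rep p′ v → p ≡ p′
  Rep-functional (root _ p≡f)   (root _ p′≡f)   = trans p≡f (sym p′≡f)
  Rep-functional (root v≡i _)   (edge v≢i _)    = contradiction v≡i v≢i
  Rep-functional (edge v≢i _)   (root v≡i _)    = contradiction v≡i v≢i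
  Rep-functional (edge _ ends)  (edge _ ends′)  = Ends-unique _ _ ends ends′

  -- If `f` joined j to its parent, i and j would be adjacent; d > 1 excludes this, so no element of
  -- B is represented twice.
  f∉E : ∀ {v} → v ≢ i → ¬ Ends f v (parent i v)
  f∉E v≢i (inj₁ (i≡v , _))     = v≢i (sym i≡v)
  f∉E {v} v≢i (inj₂ (i≡pv , refl)) = ℕ.<⇒≢ 1<d (trans (sym (Adj⇒d≡1 (subst (λ x → Adj x v) (sym i≡pv) (symm (parent-Adj v≢i))))) dij≡)

  Rep-injective : ∀ {p v v′} → Rep p v → Rep p v′ → v ≡ v′
  Rep-injective (root v≡i _)    (root v′≡i _)   = trans v≡i (sym v′≡i)
  Rep-injective (root _ refl)   (edge v≢i ends) = contradiction ends (f∉E v≢i)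
  Rep-injective (edge v≢i ends) (root _ refl)   = contradiction ends (f∉E v≢i)
  Rep-injective (edge _ (inj₁ (refl , _))) (edge _ (inj₁ (refl , _))) = refl
  Rep-injective (edge _ (inj₂ (_ , refl))) (edge _ (inj₂ (_ , refl))) = refl
  Rep-injective (edge v≢i (inj₁ (refl , b≡pv))) (edge _ (inj₂ (a≡pv′ , refl))) =
    contradiction (sym a≡pv′) (parent-asym v≢i (sym b≡pv))
  Rep-injective (edge v≢i (inj₂ (a≡pv , refl))) (edge _ (inj₁ (refl , b≡pv′))) =
    contradiction (sym b≡pv′) (parent-asym v≢i (sym a≡pv))

  label : Fin n → Fin 3
  label v with v ≟ i | onPath? v
  ... | yes _ | _     = zero
  ... | no _  | yes _ = suc zero
  ... | no _  | no _  = suc (suc zero)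

  entry-f : ∀ {v} → v ≢ i → min4 i j v (parent i v) ≡ entry zero (label v)
  entry-f {v} v≢i with v ≟ i | onPath? v
  ... | yes v≡i | _       = contradiction v≡i v≢i
  ... | no _    | yes on  = min4-onPath on
  ... | no _    | no off  = min4-offPath v≢i off

  label-root : label i ≡ zero
  label-root with i ≟ i
  ... | yes _  = refl
  ... | no i≢i = contradiction refl i≢i

  label-edge : ∀ {v} → v ≢ i → ∃ λ s → label v ≡ suc s
  label-edge {v} v≢i with v ≟ i | onPath? v
  ... | yes v≡i | _     = contradiction v≡i v≢i
  ... | no _    | yes _ = _ , refl
  ... | no _    | no _  = _ , refl

  label-onPath : ∀ {v} → OnPath v → label v ≡ suc zero
  label-onPath {v} on@(t , qt≡v) with v ≟ i | onPath? v
  ... | yes v≡i | _      = contradiction (trans qt≡v v≡i) (q≢i (toℕ<n t))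
  ... | no _    | yes _  = refl
  ... | no _    | no off = contradiction on off

  label-offPath : ∀ {v} → ¬ OnPath v → label v ≢ suc zero
  label-offPath {v} off with v ≟ i | onPath? v
  ... | yes _ | _      = λ ()
  ... | no _  | yes on = contradiction on off
  ... | no _  | no _   = λ ()

  Min4PC-entry : ∀ p p′ {v v′} → Rep p v → Rep p′ v′ → v ≢ v′ → Min4PC T p p′ ≡ entry (label v) (label v′)
  Min4PC-entry p p′ (root refl _) (root refl _) v≢v′ = contradiction refl v≢v′
  Min4PC-entry p p′ (root refl refl) (edge v′≢i ends) _ rewrite label-root =
    trans (Min4PC-Ends f p′ (inj₁ (refl , refl)) ends) (entry-f v′≢i)
  Min4PC-entry p p′ {v} (edge v≢i ends) (root refl refl) _ rewrite label-root = begin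
    Min4PC T p f                    ≡⟨ Min4PC-Ends p f ends (inj₁ (refl , refl)) ⟩
    min4 v (parent i v) i j         ≡⟨ min4-swap v (parent i v) i j ⟩
    min4 i j v (parent i v)         ≡⟨ entry-f v≢i ⟩
    entry zero (label v)            ≡⟨ entry-sym-f (label v) ⟩
    entry (label v) zero            ∎
    where open ≡-Reasoning
  Min4PC-entry p p′ {v} {v′} (edge v≢i ends) (edge v′≢i ends′) v≢v′ = begin
    Min4PC T p p′                                ≡⟨ Min4PC-Ends p p′ ends ends′ ⟩
    min4 v (parent i v) v′ (parent i v′)         ≡⟨ min4-distinct-edges (parent-Adj v≢i) (parent-Adj v′≢i) (v≢v′ ∘ proj₁)
                                                      -- In the reversed match each vertex would be
                                                      -- the parent of the other.
                                                      (λ (v≡ , v′≡) → parent-asym v≢i v′≡ (sym v≡)) ⟩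
    2                                            ≡⟨ cong₂ entry (proj₂ (label-edge v≢i)) (proj₂ (label-edge v′≢i)) ⟨
    entry (label v) (label v′)                   ∎
    where open ≡-Reasoning

-- Block sizes as ring elements

module Counting {c ℓ} (R : CommutativeRing c ℓ) where
  open CommutativeRing R hiding (zero)
  open Algebra.Properties.Semiring.Mult semiring using () renaming (_×_ to _·_)
  open Algebra.Properties.Semiring.Sum semiring
  open DeterminantProperties R using (sum-zero; indicator; count)
  open Relation.Binary.Reasoning.Setoid setoid

  sum-single : ∀ {m} (g : Fin m → Carrier) t → (∀ s → s ≢ t → g s ≈ 0#) → sum g ≈ g t
  sum-single {suc m} g t g≈0 = begin
    sum g                            ≈⟨ sum-remove {i = t} g ⟩
    g t + sum (g ∘ punchIn t)        ≈⟨ +-congˡ (sum-zero λ s → g≈0 (punchIn t s) (punchInᵢ≢i t s)) ⟩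
    g t + 0#                         ≈⟨ +-identityʳ (g t) ⟩
    g t                              ∎

  indicator-≡ : ∀ {q} {s t : Fin q} → s ≡ t → indicator s t ≈ 1#
  indicator-≡ {s = s} {t} s≡t rewrite dec-true (s ≟ t) s≡t = refl

  indicator-≢ : ∀ {q} {s t : Fin q} → s ≢ t → indicator s t ≈ 0#
  indicator-≢ {s = s} {t} s≢t rewrite dec-false (s ≟ t) s≢t = refl

  count-single : ∀ {m q} (l : Fin m → Fin q) {v t} → l v ≡ t → (∀ u → u ≢ v → l u ≢ t) → count l t ≈ 1#
  count-single l {v} {t} lv≡t lu≢t = trans
    (sum-single (λ u → indicator (l u) t) v λ u u≢v → indicator-≢ (lu≢t u u≢v)) (indicator-≡ lv≡t)

  -- By injectivity of `e`, the indicator of the fibre over t is the sum of the indicators of the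
  -- points `e s`; exchanging the two sums leaves one 1 for each s.
  count-image : ∀ {m q k} (l : Fin m → Fin q) {t} (e : Fin k → Fin m) → (∀ {r s} → e r ≡ e s → r ≡ s) →
                (∀ s → l (e s) ≡ t) → (∀ v → ¬ ∃ (λ s → e s ≡ v) → l v ≢ t) → count l t ≈ k · 1#
  count-image {m} {k = k} l {t} e e-injective l-image l-rest = begin
    sum (λ v → indicator (l v) t)                 ≈⟨ sum-cong-≋ fibre ⟩
    sum (λ v → sum λ s → indicator (e s) v)       ≈⟨ ∑-comm (λ v s → indicator (e s) v) ⟩
    sum (λ s → sum λ v → indicator (e s) v)       ≈⟨ sum-cong-≋ (λ s → trans (sum-single (indicator (e s)) (e s) (λ v v≢ → indicator-≢ (v≢ ∘ ≡.sym))) (indicator-≡ {s = e s} ≡.refl)) ⟩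
    sum {k} (λ s → 1#)                            ≈⟨ sum-replicate k ⟩
    k · 1#                                        ∎
    where
    fibre : ∀ v → indicator (l v) t ≈ sum λ s → indicator (e s) v
    fibre v with any? (λ s → e s ≟ v)
    ... | yes (s , ≡.refl) = trans (indicator-≡ (l-image s)) (sym (trans
            (sum-single (λ r → indicator (e r) (e s)) s λ r r≢s → indicator-≢ (r≢s ∘ e-injective)) (indicator-≡ {s = e s} ≡.refl)))
    ... | no ¬∃ = trans (indicator-≢ (l-rest v ¬∃)) (sym (sum-zero λ s → indicator-≢ λ es≡v → ¬∃ (s , es≡v)))

  -- Fixes the size of the third block as what the first two leave over, so the edges off the path
  -- are never enumerated.
  count-total : ∀ {m} (l : Fin m → Fin 3) → count l zero + (count l (suc zero) + count l (suc (suc zero))) ≈ m · 1#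
  count-total {m} l = begin
    count l zero + (count l (suc zero) + count l (suc (suc zero)))
      ≈⟨ +-congˡ (∑-distrib-+ (λ v → indicator (l v) (suc zero)) (λ v → indicator (l v) (suc (suc zero)))) ⟨
    count l zero + sum (λ v → indicator (l v) (suc zero) + indicator (l v) (suc (suc zero)))
      ≈⟨ ∑-distrib-+ (λ v → indicator (l v) zero) _ ⟨
    sum (λ v → indicator (l v) zero + (indicator (l v) (suc zero) + indicator (l v) (suc (suc zero))))
      ≈⟨ sum-cong-≋ (λ v → partition (l v)) ⟩
    sum {m} (λ v → 1#)
      ≈⟨ sum-replicate m ⟩
    m · 1# ∎
    where
    partition : ∀ t → indicator t zero + (indicator t (suc zero) + indicator t (suc (suc zero))) ≈ 1#
    partition zero             = trans (+-congˡ (+-identityˡ 0#)) (+-identityʳ 1#)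
    partition (suc zero)       = trans (+-identityˡ _) (+-identityʳ 1#)
    partition (suc (suc zero)) = trans (+-identityˡ _) (+-identityˡ 1#)

-- The determinant of the 3 × 3 quotient matrix

module Formula {a b} (S : RawRing a b) (numeral : ℕ → RawRing.Carrier S) (x e N : RawRing.Carrier S) where
  open RawRing S
  open Determinant S using (det)

  D : Carrier
  D = numeral 1 + e

  -- The block sizes 1, d and n - 1 - d. The free variable is `e`, standing for d - 1.
  k : Fin 3 → Carrier
  k zero             = numeral 1
  k (suc zero)       = D
  k (suc (suc zero)) = N + - (numeral 1 + D)

  w : Fin 3 → Fin 3 → Carrier
  w zero             zero             = numeral 2
  w zero             (suc zero)       = e
  w zero             (suc (suc zero)) = numeral 1 + (numeral 1 + e)
  w (suc _)          (suc _)          = numeral 2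
  w (suc zero)       zero             = e
  w (suc (suc zero)) zero             = numeral 1 + (numeral 1 + e)

  quotient : Matrix (Fin 3) Carrier
  quotient r c = (if does (r ≟ c) then x + numeral 2 else 0#) + - (w r c * k c)

  -- The unfolded form of the exponent 2 in `g`, so that the coefficients of `g` have literally this
  -- shape.
  square : Carrier → Carrier
  square a = a * (a * 1#)

  c₀ c₁ c₂ horner determinant : Carrier
  c₀ = - (numeral 2 * square (D + - numeral 1) * (N + - numeral 1))
  c₁ = - (N * square D + - (numeral 5 * square D) + numeral 2 * N * D + - (numeral 2 * D) + numeral 5 * N + - numeral 9)
  c₂ = - (numeral 2 * N + - numeral 6)
  horner = c₀ + x * (c₁ + x * (c₂ + x * 1#))
  determinant = det quotient

module CharacteristicPolynomial
  {c ℓ c′ ℓ′} (K : CommutativeRing c ℓ) (P : CommutativeRing c′ ℓ′)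
  (C : CommutativeRing.Carrier K → CommutativeRing.Carrier P)
  (C-isHom : RingMorphisms.IsRingHomomorphism (CommutativeRing.rawRing K) (CommutativeRing.rawRing P) C)
  (x : CommutativeRing.Carrier P) (n d′ : ℕ) where

  private
    module K = CommutativeRing K
    module P = CommutativeRing P

  open P hiding (zero; rawRing)
  open Algebra.Properties.Semiring.Exp semiring using (_^_)
  open Algebra.Properties.Semiring.Mult semiring using () renaming (_×_ to _·_)
  open Algebra.Properties.Semiring.Mult.TCOptimised semiring using (×ᵤ≈×)
  open Relation.Binary.Reasoning.Setoid setoid
  open DeterminantProperties P
  open IntegerSolver P
  open Entries d′
  open Spectrum K.rawRing using (ι; g; coeff)
  open RingMorphisms.IsRingHomomorphism C-isHom

  C-ι : ∀ k → C (ι k) ≈ k · 1#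
  C-ι zero    = 0#-homo
  C-ι (suc k) = trans (+-homo _ _) (+-cong 1#-homo (C-ι k))

  -- Joins the plain multiples used by `ι` to the optimised ones used by the solver.
  numeral : ∀ k → C (ι k) ≈ fromℤ (+ k)
  numeral k = trans (C-ι k) (×ᵤ≈× k 1#)

  cubic : Carrier
  cubic = C (coeff G 0) + x * (C (coeff G 1) + x * (C (coeff G 2) + x * 1#))
    where G = g n (suc d′)

  private
    N e : Carrier
    N = C (ι n)
    e = C (ι d′)

    infixl 6 _⊞_
    infixl 7 _⊠_
    -- These combinators push `C` through an expression; a proof built from them has the shape of
    -- the coefficient it treats.
    _⊞_ : ∀ {a b u v} → C a ≈ u → C b ≈ v → C (a K.+ b) ≈ u + v
    p ⊞ q = trans (+-homo _ _) (+-cong p q)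
    _⊠_ : ∀ {a b u v} → C a ≈ u → C b ≈ v → C (a K.* b) ≈ u * v
    p ⊠ q = trans (*-homo _ _) (*-cong p q)
    ⊟_ : ∀ {a u} → C a ≈ u → C (K.- a) ≈ - u
    ⊟ p = trans (-‿homo _) (-‿cong p)

    C-D : C (ι (suc d′)) ≈ 1# + e
    C-D = 1#-homo ⊞ refl

    module Values = Formula P.rawRing (fromℤ ∘ +_) x e N

    -- A polynomial identity over the integers in three indeterminates; both sides have the same
    -- normal form.
    quotient-expand : det Values.quotient ≈ Values.horner
    quotient-expand = solve 3 (λ x e N → Formula.determinant (expressions 3) num x e N := Formula.horner (expressions 3) num x e N)
      refl x e N
      where
      num : ℕ → Polynomial 3
      num k = con (+ k)

  det-quotient : ∀ k → k zero ≈ 1# → k (suc zero) ≈ suc d′ · 1# →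
    k zero + (k (suc zero) + k (suc (suc zero))) ≈ n · 1# →
    det (weighted (x + C (ι 2)) (λ s t → C (ι (entry s t))) id k) ≈ cubic
  det-quotient k k₀ k₁ k-total = begin
    det (weighted (x + C (ι 2)) (λ s t → C (ι (entry s t))) id k)
      ≈⟨ det-cong _ Values.quotient (λ r c → +-cong (scalar-cong r c) (-‿cong (*-cong (w≈ r c) (k≈ c)))) ⟩
    det Values.quotient
      ≈⟨ quotient-expand ⟩
    Values.horner
      ≈⟨ +-cong c₀ (*-congˡ (+-cong c₁ (*-congˡ (+-cong c₂ refl)))) ⟨
    cubic ∎
    where
    scalar-cong : ∀ (r c : Fin 3) → scalar (x + C (ι 2)) r c ≈ scalar (x + fromℤ (+ 2)) r c
    scalar-cong r c with does (r ≟ c)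
    ... | true  = +-congˡ (numeral 2)
    ... | false = refl
    two+e : C (ι (suc (suc d′))) ≈ 1# + (1# + e)
    two+e = 1#-homo ⊞ C-D
    w≈ : ∀ r c → C (ι (entry r c)) ≈ Values.w r c
    w≈ zero             zero             = numeral 2
    w≈ zero             (suc zero)       = refl
    w≈ zero             (suc (suc zero)) = two+e
    w≈ (suc zero)       zero             = refl
    w≈ (suc (suc zero)) zero             = two+e
    w≈ (suc _)          (suc _)          = numeral 2
    k₁≈D : k (suc zero) ≈ 1# + e
    k₁≈D = trans k₁ (+-congˡ (sym (C-ι d′)))
    k≈ : ∀ c → k c ≈ Values.k c
    k≈ zero             = k₀
    k≈ (suc zero)       = k₁≈D
    k≈ (suc (suc zero)) = begin
      -- The third size is the total n minus the two known sizes.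
      k (suc (suc zero))
        ≈⟨ solve 3 (λ a b c → c := (a :+ (b :+ c)) :- (a :+ b)) refl (k zero) (k (suc zero)) _ ⟩
      (k zero + (k (suc zero) + k (suc (suc zero)))) - (k zero + k (suc zero))
        ≈⟨ +-cong (trans k-total (sym (C-ι n))) (-‿cong (+-cong k₀ k₁≈D)) ⟩
      N - (1# + (1# + e)) ∎
    sq : ∀ {a u} → C a ≈ u → C (a K.* (a K.* K.1#)) ≈ u * (u * 1#)
    sq p = p ⊠ (p ⊠ 1#-homo)
    c₀ : C (coeff (g n (suc d′)) 0) ≈ Values.c₀
    c₀ = ⊟ (numeral 2 ⊠ sq (C-D ⊞ ⊟ numeral 1) ⊠ (refl ⊞ ⊟ numeral 1))
    c₁ : C (coeff (g n (suc d′)) 1) ≈ Values.c₁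
    c₁ = ⊟ (refl ⊠ sq C-D ⊞ ⊟ (numeral 5 ⊠ sq C-D) ⊞ numeral 2 ⊠ refl ⊠ C-D ⊞ ⊟ (numeral 2 ⊠ C-D) ⊞ numeral 5 ⊠ refl ⊞ ⊟ numeral 9)
    c₂ : C (coeff (g n (suc d′)) 2) ≈ Values.c₂
    c₂ = ⊟ (numeral 2 ⊠ refl ⊞ ⊟ numeral 6)

  -- Blowing up from three labels leaves y³ on the left, while n ≥ 3 splits y³ off yⁿ on the right.
  -- Cancelling y is a hypothesis because in an arbitrary commutative ring y may be a zero divisor.
  det-labelled : (∀ p q → (x + C (ι 2)) * p ≈ (x + C (ι 2)) * q → p ≈ q) → 3 ℕ.≤ n →
    ∀ {m} → m ≡ n → (A : Matrix (Fin m) ℕ) (l : Fin m → Fin 3) →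
    (∀ r → A r r ≡ 0) → (∀ r c → r ≢ c → A r c ≡ entry (l r) (l c)) →
    count l zero ≈ 1# → count l (suc zero) ≈ suc d′ · 1# →
    count l zero + (count l (suc zero) + count l (suc (suc zero))) ≈ n · 1# →
    det (λ r c → (if does (r ≟ c) then x else 0#) - C (ι (A r c))) ≈ (x + C (ι 2)) ^ (n ∸ 3) * cubic
  det-labelled cancel 3≤n {m} m≡n A l A-diagonal A-entry k₀ k₁ k-total =
    cancel _ _ (cancel _ _ (cancel _ _ (begin
      y * (y * (y * det B))
        ≈⟨ solve 2 (λ y b → y :* (y :* (y :* b)) := y :* (y :* (y :* con (+ 1))) :* b) refl y (det B) ⟩
      y ^ 3 * det B
        ≈⟨ *-congˡ (det-cong B (λ r c → scalar y r c - w (l r) (l c)) B≈) ⟩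
      y ^ 3 * det (λ r c → scalar y r c - w (l r) (l c))
        ≈⟨ det-blowup y w l ⟩
      y ^ m * det (weighted y w id (count l))
        ≈⟨ *-cong (reflexive (≡.cong (y ^_) (≡.trans m≡n (≡.sym (ℕ.m+[n∸m]≡n 3≤n))))) (det-quotient (count l) k₀ k₁ k-total) ⟩
      y * (y * (y * y ^ (n ∸ 3))) * cubic
        ≈⟨ solve 3 (λ y z b → y :* (y :* (y :* z)) :* b := y :* (y :* (y :* (z :* b)))) refl y (y ^ (n ∸ 3)) cubic ⟩
      y * (y * (y * (y ^ (n ∸ 3) * cubic))) ∎)))
    where
    y = x + C (ι 2)
    w : Fin 3 → Fin 3 → Carrier
    w s t = C (ι (entry s t))
    B : Matrix (Fin m) Carrier
    B r c = (if does (r ≟ c) then x else 0#) - C (ι (A r c))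
    B≈ : ∀ r c → B r c ≈ scalar y r c - w (l r) (l c)
    B≈ r c with r ≟ c
    ... | yes ≡.refl rewrite A-diagonal r | entry-diagonal (l r) =
      -- The shift itself: x - 0 = (x + 2) - 2.
      trans (+-congˡ (-‿cong 0#-homo)) (solve 2 (λ x t → x :- con (+ 0) := (x :+ t) :- t) refl x (C (ι 2)))
    ... | no r≢c rewrite A-entry r c r≢c = refl

-- From an enumeration of B to the labelled vertices

module Enumerated {n} (T : Tree n) (i j : Fin n) .(i<j : i Fin.< j)
                  {d′} (dij≡ : Tree.d T i j ≡ suc d′) (1<d : 1 < suc d′)
                  {m} (b : Fin m → 𝒱₂ n) (enum : Enumerates b (E T ∪ ｛ pair i j i<j ｝)) where
  open Path T i j i<j dij≡ 1<d
  open Entries d′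
  open Enumerates enum

  vertex : Fin m → Fin n
  vertex r = proj₁ (Rep-total (b r) (sound r))

  vertex-Rep : ∀ r → Rep (b r) (vertex r)
  vertex-Rep r = proj₂ (Rep-total (b r) (sound r))

  index : Fin n → Fin m
  index v = proj₁ (complete (proj₁ (proj₂ (Rep-surjective v))))

  index-Rep : ∀ v → Rep (b (index v)) v
  index-Rep v = let _ , p∈ , rep = Rep-surjective v in ≡.subst (λ p → Rep p v) (≡.sym (proj₂ (complete p∈))) rep

  vertex↔ : Permutation m n
  vertex↔ = permutation vertex index
    (λ v → Rep-injective (vertex-Rep (index v)) (index-Rep v))
    (λ r → injective (Rep-functional (index-Rep (vertex r)) (vertex-Rep r)))

  m≡n : m ≡ n
  m≡n = ↔⇒≡ vertex↔

  -- The path between i and j has d + 1 distinct vertices, and d is at least 2.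
  3≤n : 3 ℕ.≤ n
  3≤n = ℕ.≤-trans (s≤s 1<d) (injective⇒≤ {f = q ∘ toℕ {suc (suc d′)}}
    λ {s} {t} → toℕ-injective ∘ q-injective (ℕ.s≤s⁻¹ (toℕ<n s)) (ℕ.s≤s⁻¹ (toℕ<n t)))

  principal-entry : ∀ r c → r ≢ c → principal (Min4PC T) b r c ≡ entry (label (vertex r)) (label (vertex c))
  principal-entry r c r≢c = Min4PC-entry (b r) (b c) (vertex-Rep r) (vertex-Rep c) λ vr≡vc →
    r≢c (injective (Rep-functional (≡.subst (Rep (b r)) vr≡vc (vertex-Rep r)) (vertex-Rep c)))

  module _ {c ℓ} (R : CommutativeRing c ℓ) where
    private
      module R = CommutativeRing R
    open R using (_≈_; 1#)
    open Algebra.Properties.Semiring.Mult R.semiring using () renaming (_×_ to _·_)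
    open Algebra.Properties.Semiring.Sum R.semiring using (sum-permute)
    open DeterminantProperties R using (count; indicator)
    open Counting R

    count-vertex : ∀ t → count (label ∘ vertex) t ≈ count label t
    count-vertex t = R.sym (sum-permute (λ v → indicator (label v) t) vertex↔)

    count-f : count (label ∘ vertex) zero ≈ 1#
    count-f = R.trans (count-vertex zero) (count-single label label-root λ v v≢i lv≡0 →
      Fin-0≢suc (≡.trans (≡.sym lv≡0) (proj₂ (label-edge v≢i))))
      where
      Fin-0≢suc : ∀ {k} {s : Fin k} → zero ≢ suc s
      Fin-0≢suc ()

    count-path : count (label ∘ vertex) (suc zero) ≈ suc d′ · 1#
    count-path = R.trans (count-vertex (suc zero)) (count-image label (q ∘ toℕ)
      (λ {s} {t} → toℕ-injective ∘ q-injective (toℕ≤n s) (toℕ≤n t))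
      (λ s → label-onPath (s , ≡.refl)) (λ v → label-offPath))

    count-all : count (label ∘ vertex) zero R.+ (count (label ∘ vertex) (suc zero) R.+ count (label ∘ vertex) (suc (suc zero)))
                ≈ n · 1#
    count-all = R.trans (count-total (label ∘ vertex)) (R.reflexive (≡.cong (_· 1#) m≡n))

-- The characteristic polynomial and the list of eigenvalues

module _ {c ℓ} (R : CommutativeRing c ℓ) where
  private
    module R = CommutativeRing R
  open Spectrum R.rawRing
  open PolynomialProperties R
  private
    module P = CommutativeRing polyCommutativeRing
  open RingMorphisms R.rawRing P.rawRing using (IsRingHomomorphism)
  open Algebra.Properties.Ring R.ring using (-‿involutive)

  constant-isRingHomomorphism : IsRingHomomorphism constant
  constant-isRingHomomorphism = record
    { isSemiringHomomorphism = record
      { isNearSemiringHomomorphism = record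
        { +-isMonoidHomomorphism = record
          { isMagmaHomomorphism = record
            { isRelHomomorphism = record { cong = constant-cong }
            ; homo = λ _ _ _ → R.refl }
          ; ε-homo = constant-0# }
        ; *-homo = constant-* }
      ; 1#-homo = λ _ → R.refl }
    ; -‿homo = λ _ _ → R.refl }

  ∷-horner-cong : ∀ a p p′ → p ≈ₚ p′ → a ∷ p ≈ₚ constant a +ₚ X *ₚ p′
  ∷-horner-cong a p p′ p≈p′ k = R.trans (∷-horner a p k)
    (P.+-congˡ {constant a} {X *ₚ p} {X *ₚ p′} (P.*-congˡ {X} {p} {p′} p≈p′) k)

  charpoly-Min4PC : ∀ {n} (T : Tree n) (i j : Fin n) .(i<j : i Fin.< j) {d′} → Tree.d T i j ≡ suc d′ → 1 < suc d′ →
    ∀ {m} (b : Fin m → 𝒱₂ n) → Enumerates b (E T ∪ ｛ pair i j i<j ｝) →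
    charpoly (fromℕ-matrix (principal (Min4PC T) b)) ≈ₚ (X +ₚ constant (ι 2)) ^ₚ (n ∸ 3) *ₚ g n (suc d′)
  charpoly-Min4PC {n} T i j i<j {d′} dij≡ 1<d {m} b enum =
    P.trans {charpoly (fromℕ-matrix (principal (Min4PC T) b))} {y ^ₚ (n ∸ 3) *ₚ cubic} {y ^ₚ (n ∸ 3) *ₚ G}
      (det-labelled (X+a-cancel (ι 2)) 3≤n m≡n (principal (Min4PC T) b) (label ∘ vertex)
        (λ r → Min4PC-diagonal (b r)) principal-entry (count-f P-ring) (count-path P-ring) (count-all P-ring))
      (P.*-congˡ {y ^ₚ (n ∸ 3)} {cubic} {G} (P.sym {G} {cubic} G≈cubic))
    where
    P-ring = polyCommutativeRing
    open TreeProperties T using (Min4PC-diagonal)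
    open Enumerated T i j i<j dij≡ 1<d b enum
    open Path T i j i<j dij≡ 1<d using (label)
    open CharacteristicPolynomial R P-ring constant constant-isRingHomomorphism X n d′
    y = X +ₚ constant (ι 2)
    G = g n (suc d′)
    G≈cubic : G ≈ₚ cubic
    G≈cubic = ∷-horner-cong a₀ (a₁ ∷ a₂ ∷ 1ₚ) (constant a₁ +ₚ X *ₚ inner)
      (∷-horner-cong a₁ (a₂ ∷ 1ₚ) inner (∷-horner a₂ 1ₚ))
      where
      a₀ = coeff G 0
      a₁ = coeff G 1
      a₂ = coeff G 2
      1ₚ = constant R.1#
      inner = constant a₂ +ₚ X *ₚ 1ₚ

  roots : List R.Carrier → Poly
  roots = foldr (λ r q → (X +ₚ (-ₚ constant r)) *ₚ q) (constant R.1#)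

  -- The factor X + a is rewritten as X - (-a), the form in which `HasRoots` records the root -a.
  roots-replicate : ∀ a k rs → (X +ₚ constant a) ^ₚ k *ₚ roots rs ≈ₚ roots (replicate k (R.- a) ++ rs)
  roots-replicate a zero    rs = P.*-identityˡ (roots rs)
  roots-replicate a (suc k) rs = P.trans {y *ₚ y ^ₚ k *ₚ roots rs} {y *ₚ (y ^ₚ k *ₚ roots rs)} {y′ *ₚ rest}
    (P.*-assoc y (y ^ₚ k) (roots rs)) (P.*-cong {y} {y′} {y ^ₚ k *ₚ roots rs} {rest} y≈y′ (roots-replicate a k rs))
    where
    y y′ rest : Poly
    y    = X +ₚ constant a
    y′   = X +ₚ (-ₚ constant (R.- a))
    rest = roots (replicate k (R.- a) ++ rs)
    y≈y′ : y ≈ₚ y′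
    y≈y′ zero    = R.+-congˡ (R.sym (-‿involutive a))
    y≈y′ (suc k) = R.refl

  eigenvalues : ∀ {m} (M : Matrix (Fin m) R.Carrier) k G rs → charpoly M ≈ₚ (X +ₚ constant (ι 2)) ^ₚ k *ₚ G →
    HasRoots G rs → HasEigenvalues M (replicate k (R.- ι 2) ++ rs)
  eigenvalues M k G rs charpoly≈ G≈ t = R.trans (charpoly≈ t)
    (R.trans (P.*-congˡ {(X +ₚ constant (ι 2)) ^ₚ k} {G} {roots rs} G≈ t) (roots-replicate (ι 2) k rs t))

-- The factorisation makes sense over every field, whether or not `g` splits there. Listing the
-- eigenvalues presupposes three roots of `g`, so these are quantified in the second component.
theorem3p4 : ∀ (n : ℕ) (T : Tree n) (f : 𝒱₂ n) → 1 < dist T f →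
             ∀ (m : ℕ) (b : Fin m → 𝒱₂ n) → Enumerates b (E T ∪ ｛ f ｝) →
             ∀ {c ℓ₁ ℓ₂} (K : HeytingField c ℓ₁ ℓ₂) →
             let open HeytingField K using (-_)
                 open Spectrum (rawRing K)
                 M = fromℕ-matrix (principal (Min4PC T) b)
             in (charpoly M ≈ₚ (X +ₚ constant (ι 2)) ^ₚ (n ∸ 3) *ₚ g n (dist T f))
                × (∀ r₁ r₂ r₃ → HasRoots (g n (dist T f)) (r₁ ∷ r₂ ∷ r₃ ∷ []) →
                   HasEigenvalues M (replicate (n ∸ 3) (- ι 2) ++ r₁ ∷ r₂ ∷ r₃ ∷ []))
theorem3p4 n T (pair i j i<j) 1<d m b enum K =
  charpoly≈ , λ r₁ r₂ r₃ → eigenvalues R M (n ∸ 3) (g n (d i j)) (r₁ ∷ r₂ ∷ r₃ ∷ []) charpoly≈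
  where
  open Tree T using (d)
  open Spectrum (rawRing K)
  R = HeytingCommutativeRing.commutativeRing (HeytingField.heytingCommutativeRing K)
  M = fromℕ-matrix (principal (Min4PC T) b)
  -- The distance is generalised to a variable so that it can be matched as `suc d′`; 1 < k leaves
  -- no zero case.
  generalised : ∀ k → d i j ≡ k → 1 < k → charpoly M ≈ₚ (X +ₚ constant (ι 2)) ^ₚ (n ∸ 3) *ₚ g n k
  generalised (suc d′) dij≡ 1<k = charpoly-Min4PC R T i j i<j dij≡ 1<k b enum
  charpoly≈ = generalised (d i j) ≡.refl 1<d
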